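{- The set $S_0^{3,ntr}$ includes a primitive element (over $\mathbb{Q}$) of any real cubic field which is not totally real. The same is true of $S_{ -3}^{3,ntr}$.
   Context: A real cubic field is a subfield of $\mathbb{R}$ of degree three over $\mathbb{Q}$; it is totally real if all of its embeddings into $\mathbb{C}$ have image in $\mathbb{R}$. For integers $m, n$ satisfying $m^2-3n \le 0$ and $m+n \ge 1$, define $$I_{m,n}^{3,ntr} := \{\alpha \in (0,1) \mid \alpha^3+m\alpha^2+n\alpha+d=0 \text{ for some } d \in \mathbb{Z},\ -(m+n) \le d \le -1\}.$$ For $m \in \{0,-1,-2,-3\}$, define $$S_m^{3,ntr} := \bigcup_{n \ge -m+1} I_{m,n}^{3,ntr}.$$ -}

module Defs where

open import Algebra.Bundles.Raw using (RawRing)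
import Algebra.Definitions.RawSemiring as RawSemiringDefinitions
open import Algebra.Morphism.Structures using (module RingMorphisms)
open import Data.Fin.Base using (Fin)
open import Data.Integer.Base as ℤ using (ℤ; +_)
open import Data.Nat.Base as ℕ using (ℕ)
import Data.Nat.Properties as ℕ
open import Data.Product.Base using (Σ-syntax; ∃; _×_; _,_; proj₁; proj₂)
open import Data.Rational.Base as ℚ using (ℚ; 0ℚ; 1ℚ; ½; ∣_∣; Positive)
import Data.Rational.Properties as ℚ
open import Data.Rational.Solver using (module +-*-Solver)
open import Data.Vec.Functional using (Vector)
open import Level using (Level; 0ℓ; suc)
open import Relation.Binary.PropositionalEquality using (_≡_; refl; sym; trans; cong; cong₂; subst)
open import Relation.Unary using (Pred; _∈_; _≐_)

-- Real numbers as Cauchy sequences of rationals, up to _≈_.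

IsCauchy : Pred (ℕ → ℚ) 0ℓ
IsCauchy x = ∀ ε → 0ℚ ℚ.< ε → Σ[ N ∈ ℕ ] (∀ i j → N ℕ.≤ i → N ℕ.≤ j → ∣ x i ℚ.- x j ∣ ℚ.< ε)

record ℝ : Set where
  constructor mkℝ
  field
    seq    : ℕ → ℚ
    cauchy : IsCauchy seq

open ℝ public

-- Abstract, so that comparing two reals never unfolds these estimates.
module Cauchy where

  abstract

    0<½ε : ∀ ε → 0ℚ ℚ.< ε → 0ℚ ℚ.< ½ ℚ.* ε
    0<½ε ε ε>0 = ℚ.positive⁻¹ (½ ℚ.* ε) {{ℚ.pos*pos⇒pos ½ ε {{ℚ.positive ε>0}}}}

    ½+½ : ∀ ε → ½ ℚ.* ε ℚ.+ ½ ℚ.* ε ≡ ε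
    ½+½ ε = trans (sym (ℚ.*-distribʳ-+ ε ½ ½)) (ℚ.*-identityˡ ε)

    constant-cauchy : ∀ q → IsCauchy (λ _ → q)
    constant-cauchy q ε ε>0 = 0 , λ _ _ _ _ →
      subst (λ p → ∣ p ∣ ℚ.< ε) (sym (ℚ.+-inverseʳ q)) ε>0

    +-cauchy : ∀ x y → IsCauchy x → IsCauchy y → IsCauchy (λ n → x n ℚ.+ y n)
    +-cauchy x y cx cy ε ε>0 with cx (½ ℚ.* ε) (0<½ε ε ε>0) | cy (½ ℚ.* ε) (0<½ε ε ε>0)
    ... | M , hx | N , hy = M ℕ.⊔ N , λ i j i≥ j≥ → begin-strict
      ∣ (x i ℚ.+ y i) ℚ.- (x j ℚ.+ y j) ∣     ≡⟨ cong ∣_∣ (rearrange (x i) (y i) (x j) (y j)) ⟩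
      ∣ (x i ℚ.- x j) ℚ.+ (y i ℚ.- y j) ∣     ≤⟨ ℚ.∣p+q∣≤∣p∣+∣q∣ (x i ℚ.- x j) (y i ℚ.- y j) ⟩
      ∣ x i ℚ.- x j ∣ ℚ.+ ∣ y i ℚ.- y j ∣     <⟨ ℚ.+-mono-< (hx i j (ℕ.m⊔n≤o⇒m≤o M N i≥) (ℕ.m⊔n≤o⇒m≤o M N j≥))
                                                            (hy i j (ℕ.m⊔n≤o⇒n≤o M N i≥) (ℕ.m⊔n≤o⇒n≤o M N j≥)) ⟩
      ½ ℚ.* ε ℚ.+ ½ ℚ.* ε                     ≡⟨ ½+½ ε ⟩
      ε                                       ∎
      where
      open ℚ.≤-Reasoning
      rearrange : ∀ a b c d → (a ℚ.+ b) ℚ.- (c ℚ.+ d) ≡ (a ℚ.- c) ℚ.+ (b ℚ.- d)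
      rearrange = solve 4 (λ a b c d → (a :+ b) :- (c :+ d) := (a :- c) :+ (b :- d)) refl
        where open +-*-Solver

    neg-cauchy : ∀ x → IsCauchy x → IsCauchy (λ n → ℚ.- x n)
    neg-cauchy x cx ε ε>0 with cx ε ε>0
    ... | N , h = N , λ i j i≥ j≥ → subst (ℚ._< ε) (sym (flip-sign (x i) (x j))) (h i j i≥ j≥)
      where
      flip-sign : ∀ a b → ∣ ℚ.- a ℚ.- ℚ.- b ∣ ≡ ∣ a ℚ.- b ∣
      flip-sign a b = trans (cong ∣_∣ (sym (ℚ.neg-distrib-+ a (ℚ.- b)))) (ℚ.∣-p∣≡∣p∣ (a ℚ.- b))

    bounded : ∀ {x} → IsCauchy x →
              Σ[ B ∈ ℚ ] Positive B × Σ[ N ∈ ℕ ] (∀ i → N ℕ.≤ i → ∣ x i ∣ ℚ.≤ B)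
    bounded {x} cx with cx 1ℚ (ℚ.positive⁻¹ 1ℚ)
    ... | N , h = 1ℚ ℚ.+ ∣ x N ∣
                , ℚ.pos+nonNeg⇒pos 1ℚ ∣ x N ∣ {{ℚ.∣-∣-nonNeg (x N)}}
                , N , λ i i≥ → begin
      ∣ x i ∣                            ≡⟨ cong ∣_∣ (split (x i) (x N)) ⟩
      ∣ (x i ℚ.- x N) ℚ.+ x N ∣          ≤⟨ ℚ.∣p+q∣≤∣p∣+∣q∣ (x i ℚ.- x N) (x N) ⟩
      ∣ x i ℚ.- x N ∣ ℚ.+ ∣ x N ∣        ≤⟨ ℚ.+-monoˡ-≤ ∣ x N ∣ (ℚ.<⇒≤ (h i N i≥ ℕ.≤-refl)) ⟩
      1ℚ ℚ.+ ∣ x N ∣                     ∎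
      where
      open ℚ.≤-Reasoning
      split : ∀ a b → a ≡ (a ℚ.- b) ℚ.+ b
      split = solve 2 (λ a b → a := (a :- b) :+ b) refl
        where open +-*-Solver

    divide : ∀ B ε → Positive B → 0ℚ ℚ.< ε → Σ[ δ ∈ ℚ ] 0ℚ ℚ.< δ × B ℚ.* δ ≡ ε
    divide B ε B>0 ε>0 = B⁻¹ ℚ.* ε
                       , ℚ.positive⁻¹ (B⁻¹ ℚ.* ε) {{ℚ.pos*pos⇒pos B⁻¹ {{B⁻¹>0}} ε {{ℚ.positive ε>0}}}}
                       , trans (sym (ℚ.*-assoc B B⁻¹ ε))
                           (trans (cong (ℚ._* ε) (ℚ.*-inverseʳ B {{B≢0}})) (ℚ.*-identityˡ ε))
      where
      B≢0 : ℚ.NonZero B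
      B≢0 = ℚ.pos⇒nonZero B {{B>0}}
      B⁻¹ : ℚ
      B⁻¹ = ℚ.1/_ B {{B≢0}}
      B⁻¹>0 : Positive B⁻¹
      B⁻¹>0 = ℚ.1/pos⇒pos B {{B>0}}

    *-bound : ∀ {B δ} p q → Positive B → ∣ p ∣ ℚ.≤ B → ∣ q ∣ ℚ.< δ → ∣ p ℚ.* q ∣ ℚ.< B ℚ.* δ
    *-bound {B} {δ} p q B>0 p≤B q<δ = begin-strict
      ∣ p ℚ.* q ∣          ≡⟨ ℚ.∣p*q∣≡∣p∣*∣q∣ p q ⟩
      ∣ p ∣ ℚ.* ∣ q ∣      ≤⟨ ℚ.*-monoʳ-≤-nonNeg ∣ q ∣ {{ℚ.∣-∣-nonNeg q}} p≤B ⟩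
      B ℚ.* ∣ q ∣          <⟨ ℚ.*-monoʳ-<-pos B {{B>0}} q<δ ⟩
      B ℚ.* δ              ∎
      where open ℚ.≤-Reasoning

    *-estimate : ∀ ε {A B δ η} a b c d → Positive A → Positive B →
                 A ℚ.* η ≡ ½ ℚ.* ε → B ℚ.* δ ≡ ½ ℚ.* ε →
                 ∣ a ∣ ℚ.≤ A → ∣ d ∣ ℚ.≤ B → ∣ a ℚ.- c ∣ ℚ.< δ → ∣ b ℚ.- d ∣ ℚ.< η →
                 ∣ a ℚ.* b ℚ.- c ℚ.* d ∣ ℚ.< ε
    *-estimate ε {A} {B} {δ} {η} a b c d A>0 B>0 Aη≡ Bδ≡ a≤A d≤B a-c<δ b-d<η = begin-strict
      ∣ a ℚ.* b ℚ.- c ℚ.* d ∣                            ≡⟨ cong ∣_∣ (rearrange a b c d) ⟩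
      ∣ a ℚ.* (b ℚ.- d) ℚ.+ d ℚ.* (a ℚ.- c) ∣            ≤⟨ ℚ.∣p+q∣≤∣p∣+∣q∣ (a ℚ.* (b ℚ.- d)) (d ℚ.* (a ℚ.- c)) ⟩
      ∣ a ℚ.* (b ℚ.- d) ∣ ℚ.+ ∣ d ℚ.* (a ℚ.- c) ∣        <⟨ ℚ.+-mono-< (*-bound a (b ℚ.- d) A>0 a≤A b-d<η)
                                                                       (*-bound d (a ℚ.- c) B>0 d≤B a-c<δ) ⟩
      A ℚ.* η ℚ.+ B ℚ.* δ                                ≡⟨ cong₂ ℚ._+_ Aη≡ Bδ≡ ⟩
      ½ ℚ.* ε ℚ.+ ½ ℚ.* ε                                ≡⟨ ½+½ ε ⟩
      ε                                                  ∎
      where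
      open ℚ.≤-Reasoning
      rearrange : ∀ a b c d → a ℚ.* b ℚ.- c ℚ.* d ≡ a ℚ.* (b ℚ.- d) ℚ.+ d ℚ.* (a ℚ.- c)
      rearrange = solve 4 (λ a b c d → a :* b :- c :* d := a :* (b :- d) :+ d :* (a :- c)) refl
        where open +-*-Solver

    *-cauchy : ∀ x y → IsCauchy x → IsCauchy y → IsCauchy (λ n → x n ℚ.* y n)
    *-cauchy x y cx cy ε ε>0 =
      let A , A>0 , M , x≤A = bounded cx
          B , B>0 , N , y≤B = bounded cy
          δ , δ>0 , Bδ≡ = divide B (½ ℚ.* ε) B>0 (0<½ε ε ε>0)
          η , η>0 , Aη≡ = divide A (½ ℚ.* ε) A>0 (0<½ε ε ε>0)
          M′ , x-close = cx δ δ>0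
          N′ , y-close = cy η η>0
          P = M ℕ.⊔ N
          Q = M′ ℕ.⊔ N′
      in P ℕ.⊔ Q , λ i j i≥ j≥ →
        let P≤i = ℕ.m⊔n≤o⇒m≤o P Q i≥
            P≤j = ℕ.m⊔n≤o⇒m≤o P Q j≥
            Q≤i = ℕ.m⊔n≤o⇒n≤o P Q i≥
            Q≤j = ℕ.m⊔n≤o⇒n≤o P Q j≥
        in *-estimate ε (x i) (y i) (x j) (y j) A>0 B>0 Aη≡ Bδ≡
             (x≤A i (ℕ.m⊔n≤o⇒m≤o M N P≤i)) (y≤B j (ℕ.m⊔n≤o⇒n≤o M N P≤j))
             (x-close i j (ℕ.m⊔n≤o⇒m≤o M′ N′ Q≤i) (ℕ.m⊔n≤o⇒m≤o M′ N′ Q≤j))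
             (y-close i j (ℕ.m⊔n≤o⇒n≤o M′ N′ Q≤i) (ℕ.m⊔n≤o⇒n≤o M′ N′ Q≤j))

infix  8 -_
infixl 7 _*_
infixl 6 _+_
infix  4 _≈_ _<_

_≈_ : ℝ → ℝ → Set
x ≈ y = ∀ ε → 0ℚ ℚ.< ε → Σ[ N ∈ ℕ ] (∀ n → N ℕ.≤ n → ∣ seq x n ℚ.- seq y n ∣ ℚ.< ε)

_<_ : ℝ → ℝ → Set
x < y = Σ[ ε ∈ ℚ ] 0ℚ ℚ.< ε × Σ[ N ∈ ℕ ] (∀ n → N ℕ.≤ n → seq x n ℚ.+ ε ℚ.≤ seq y n)

fromℚ : ℚ → ℝ
fromℚ q = mkℝ (λ _ → q) (Cauchy.constant-cauchy q)

fromℤ : ℤ → ℝ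
fromℤ k = fromℚ (k ℚ./ 1)

0ℝ 1ℝ : ℝ
0ℝ = fromℚ 0ℚ
1ℝ = fromℚ 1ℚ

_+_ : ℝ → ℝ → ℝ
x + y = mkℝ (λ n → seq x n ℚ.+ seq y n) (Cauchy.+-cauchy (seq x) (seq y) (cauchy x) (cauchy y))

_*_ : ℝ → ℝ → ℝ
x * y = mkℝ (λ n → seq x n ℚ.* seq y n) (Cauchy.*-cauchy (seq x) (seq y) (cauchy x) (cauchy y))

-_ : ℝ → ℝ
- x = mkℝ (λ n → ℚ.- seq x n) (Cauchy.neg-cauchy (seq x) (cauchy x))

ℝ-rawRing : RawRing 0ℓ 0ℓ
ℝ-rawRing = record
  { Carrier = ℝ ; _≈_ = _≈_ ; _+_ = _+_ ; _*_ = _*_ ; -_ = -_ ; 0# = 0ℝ ; 1# = 1ℝ }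

open RawSemiringDefinitions (RawRing.rawSemiring ℝ-rawRing) public using (_^_; sum)

record ℂ : Set where
  constructor _+i_
  field
    re im : ℝ

open ℂ public

ℂ-rawRing : RawRing 0ℓ 0ℓ
ℂ-rawRing = record
  { Carrier = ℂ
  ; _≈_ = λ z w → re z ≈ re w × im z ≈ im w
  ; _+_ = λ z w → (re z + re w) +i (im z + im w)
  ; _*_ = λ z w → (re z * re w + - (im z * im w)) +i (re z * im w + im z * re w)
  ; -_  = λ z → (- re z) +i (- im z)
  ; 0#  = 0ℝ +i 0ℝ
  ; 1#  = 1ℝ +i 0ℝ
  }

-- Closure under inverses is stated relationally (x * y ≈ 1ℝ says that y is the
-- inverse of x), because x⁻¹ is constructively available only for x apart from 0.
record IsSubfield {ℓ : Level} (K : Pred ℝ ℓ) : Set ℓ where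
  field
    resp-≈         : ∀ {x y} → x ≈ y → x ∈ K → y ∈ K
    0-closed       : 0ℝ ∈ K
    1-closed       : 1ℝ ∈ K
    +-closed       : ∀ {x y} → x ∈ K → y ∈ K → x + y ∈ K
    *-closed       : ∀ {x y} → x ∈ K → y ∈ K → x * y ∈ K
    neg-closed     : ∀ {x} → x ∈ K → - x ∈ K
    inverse-closed : ∀ {x y} → x ∈ K → x * y ≈ 1ℝ → y ∈ K

combination : ∀ {n} → Vector ℚ n → Vector ℝ n → ℝ
combination q b = sum (λ i → fromℚ (q i) * b i)

record IsBasis {ℓ : Level} (K : Pred ℝ ℓ) {n : ℕ} (b : Vector ℝ n) : Set ℓ where
  field
    member      : ∀ i → b i ∈ K
    independent : ∀ q → combination q b ≈ 0ℝ → ∀ i → q i ≡ 0ℚ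
    spanning    : ∀ x → x ∈ K → Σ[ q ∈ Vector ℚ n ] x ≈ combination q b

HasDegree : {ℓ : Level} → Pred ℝ ℓ → ℕ → Set ℓ
HasDegree K n = Σ[ b ∈ Vector ℝ n ] IsBasis K b

record RealCubicField (ℓ : Level) : Set (suc ℓ) where
  field
    carrier    : Pred ℝ ℓ
    isSubfield : IsSubfield carrier
    degree     : HasDegree carrier 3

  open IsSubfield isSubfield public

  rawRing : RawRing ℓ 0ℓ
  rawRing = record
    { Carrier = Σ[ x ∈ ℝ ] x ∈ carrier
    ; _≈_ = λ x y → proj₁ x ≈ proj₁ y
    ; _+_ = λ x y → proj₁ x + proj₁ y , +-closed (proj₂ x) (proj₂ y)
    ; _*_ = λ x y → proj₁ x * proj₁ y , *-closed (proj₂ x) (proj₂ y)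
    ; -_  = λ x → - proj₁ x , neg-closed (proj₂ x)
    ; 0#  = 0ℝ , 0-closed
    ; 1#  = 1ℝ , 1-closed
    }

  IsComplexEmbedding : Pred (RawRing.Carrier rawRing → ℂ) ℓ
  IsComplexEmbedding = RingMorphisms.IsRingMonomorphism rawRing ℂ-rawRing

TotallyReal : {ℓ : Level} → RealCubicField ℓ → Set ℓ
TotallyReal K = ∀ σ → IsComplexEmbedding σ → ∀ x → im (σ x) ≈ 0ℝ
  where open RealCubicField K

-- The smallest subfield of ℝ containing α; it automatically contains ℚ.
data ℚ⟨_⟩ (α : ℝ) : Pred ℝ 0ℓ where
  generator : α ∈ ℚ⟨ α ⟩
  resp      : ∀ {x y} → x ≈ y → x ∈ ℚ⟨ α ⟩ → y ∈ ℚ⟨ α ⟩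
  zero      : 0ℝ ∈ ℚ⟨ α ⟩
  one       : 1ℝ ∈ ℚ⟨ α ⟩
  plus      : ∀ {x y} → x ∈ ℚ⟨ α ⟩ → y ∈ ℚ⟨ α ⟩ → x + y ∈ ℚ⟨ α ⟩
  times     : ∀ {x y} → x ∈ ℚ⟨ α ⟩ → y ∈ ℚ⟨ α ⟩ → x * y ∈ ℚ⟨ α ⟩
  negate    : ∀ {x} → x ∈ ℚ⟨ α ⟩ → - x ∈ ℚ⟨ α ⟩
  invert    : ∀ {x y} → x ∈ ℚ⟨ α ⟩ → x * y ≈ 1ℝ → y ∈ ℚ⟨ α ⟩

IsPrimitiveElement : {ℓ : Level} → RealCubicField ℓ → Pred ℝ ℓ
IsPrimitiveElement K α = RealCubicField.carrier K ≐ ℚ⟨ α ⟩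

-- The standing conditions on (m , n) are conjuncts of membership, so that
-- I m n is empty for inadmissible parameters.
I : ℤ → ℤ → Pred ℝ 0ℓ
I m n α =
  (m ℤ.^ 2 ℤ.- + 3 ℤ.* n ℤ.≤ + 0) × (+ 1 ℤ.≤ m ℤ.+ n) ×
  (0ℝ < α) × (α < 1ℝ) ×
  Σ[ d ∈ ℤ ] (ℤ.- (m ℤ.+ n) ℤ.≤ d) × (d ℤ.≤ ℤ.- (+ 1)) ×
    (α ^ 3 + fromℤ m * α ^ 2 + fromℤ n * α + fromℤ d ≈ 0ℝ)

S : ℤ → Pred ℝ 0ℓ
S m α = Σ[ n ∈ ℤ ] (ℤ.- m ℤ.+ + 1 ℤ.≤ n) × α ∈ I m n

{-# OPTIONS --safe #-}

-- K contains an irrational root θ of some X³ + pX + q with p, q ∈ ℤ, and the discriminant -(4p³ + 27q²) is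
-- negative since K has a non-real embedding.  With ω = 3θ² + 2p, the elements α of the rank-two lattice
-- ℤθ + ℤω are algebraic integers of trace 0, so α³ + nα + d = 0 for integers n, d; the continued fraction of
-- ω / θ provides one with 0 < α < 1.  The conjugates of α being non-real, 4n + 3α² ≥ 0, hence n ≥ 0, and
-- 0 < α < 1 then forces -n ≤ d ≤ -1.  An irrational element of a cubic field is primitive, so α is the
-- required element of S₀, and 1 - α is that of S₋₃.
module Submission where

open import Algebra.Bundles using (CommutativeRing)
open import Algebra.Morphism.Structures using (module RingMorphisms)
open import Algebra.Structures using (IsCommutativeRing)
open import Data.Empty using (⊥; ⊥-elim)
open import Data.Fin.Base using (Fin; zero; suc; punchIn)
open import Data.Fin.Patterns using (0F; 1F; 2F; 3F)
open import Data.Fin.Properties using (any?)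
open import Data.Integer.Base as ℤ using (ℤ; +_; -[1+_])
import Data.Integer.Properties as ℤ
import Data.Integer.Solver as ℤSolver
open import Data.Maybe.Base using (Maybe; just; nothing)
open import Data.Nat.Base as ℕ using (ℕ; zero; suc)
import Data.Nat.Properties as ℕ
open import Data.Product.Base using (Σ-syntax; ∃; _×_; _,_; proj₁; proj₂)
open import Data.Rational.Base as ℚ using (ℚ; 0ℚ; 1ℚ; ½; ∣_∣)
import Data.Rational.Properties as ℚ
open import Data.Rational.Solver using (module +-*-Solver)
import Data.Rational.Unnormalised.Base as ℚᵘ
import Data.Rational.Unnormalised.Properties as ℚᵘ
open import Data.Sum.Base using (_⊎_; inj₁; inj₂; [_,_]′)
open import Data.Vec.Functional using (Vector; _∷_; []; insertAt)
open import Data.Vec.Functional.Properties using (insertAt-lookup; insertAt-punchIn)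
open import Level using (Level; 0ℓ)
open import Relation.Binary.Definitions using (tri<; tri≈; tri>)
open import Relation.Binary.PropositionalEquality as ≡ using (_≡_; _≢_; cong; subst; subst₂)
open import Relation.Nullary.Decidable.Core using (Dec; yes; no; ¬?; decidable-stable)
open import Relation.Nullary.Negation using (¬_; contradiction)
open import Relation.Unary using (Pred; _∈_; _⊆_)

-- The reals are constructive: neither equality nor order is decidable, and the negation of total
-- reality hands over no embedding. Hence case distinctions on equality are made on rational
-- coefficients, and the hypothesis is used only to refute that the integer 4p³ + 27q² fails to be
-- positive, which suffices because positivity of an integer is decidable. Nearest integers are
-- replaced by integers within 2/3, which can be found by approximate comparison, and inverses are
-- computed from cubic relations. The sign of the small lattice element is read off from its
-- inverse. Trace 0 is what the missing square term in the cubics of S₀ demands. The trace-zero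
-- elements form a rank-two lattice, and since ω / θ is irrational this lattice has arbitrarily
-- small nonzero elements. The reflection of α in 1/2 preserves (0,1) and turns trace 0 into trace
-- 3, which is the case m = -3.

module IntegersInℚ where

  private
    /1≃ : ∀ k → ℚ.toℚᵘ (k ℚ./ 1) ℚᵘ.≃ ℚᵘ.mkℚᵘ k 0
    /1≃ k = ℚ.toℚᵘ-fromℚᵘ (ℚᵘ.mkℚᵘ k 0)

  abstract

    /1-+ : ∀ k l → (k ℤ.+ l) ℚ./ 1 ≡ k ℚ./ 1 ℚ.+ l ℚ./ 1
    /1-+ k l = ℚ.toℚᵘ-injective (ℚᵘ.≃-trans (/1≃ (k ℤ.+ l)) (ℚᵘ.≃-sym
      (ℚᵘ.≃-trans (ℚ.toℚᵘ-homo-+ (k ℚ./ 1) (l ℚ./ 1))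
        (ℚᵘ.≃-trans (ℚᵘ.+-cong (/1≃ k) (/1≃ l))
          (ℚᵘ.*≡* (cong (ℤ._* + 1) (≡.cong₂ ℤ._+_ (ℤ.*-identityʳ k) (ℤ.*-identityʳ l))))))))

    /1-* : ∀ k l → (k ℤ.* l) ℚ./ 1 ≡ k ℚ./ 1 ℚ.* (l ℚ./ 1)
    /1-* k l = ℚ.toℚᵘ-injective (ℚᵘ.≃-trans (/1≃ (k ℤ.* l)) (ℚᵘ.≃-sym
      (ℚᵘ.≃-trans (ℚ.toℚᵘ-homo-* (k ℚ./ 1) (l ℚ./ 1))
        (ℚᵘ.≃-trans (ℚᵘ.*-cong (/1≃ k) (/1≃ l)) ℚᵘ.≃-refl))))

    /1-neg : ∀ k → (ℤ.- k) ℚ./ 1 ≡ ℚ.- (k ℚ./ 1)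
    /1-neg k = ℚ.toℚᵘ-injective (ℚᵘ.≃-trans (/1≃ (ℤ.- k)) (ℚᵘ.≃-sym
      (ℚᵘ.≃-trans (ℚ.toℚᵘ-homo‿- (k ℚ./ 1)) (ℚᵘ.-‿cong (/1≃ k)))))

    *-denominator : ∀ q → q ℚ.* (ℚ.↧ q ℚ./ 1) ≡ ℚ.↥ q ℚ./ 1
    *-denominator q = ℚ.toℚᵘ-injective
      (ℚᵘ.≃-trans (ℚ.toℚᵘ-homo-* q (ℚ.↧ q ℚ./ 1))
        (ℚᵘ.≃-trans (ℚᵘ.*-cong (ℚᵘ.≃-refl {ℚ.toℚᵘ q}) (/1≃ (ℚ.↧ q)))
          (ℚᵘ.≃-trans (cancel q) (ℚᵘ.≃-sym (/1≃ (ℚ.↥ q))))))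
      where
      cancel : ∀ q → ℚ.toℚᵘ q ℚᵘ.* ℚᵘ.mkℚᵘ (ℚ.↧ q) 0 ℚᵘ.≃ ℚᵘ.mkℚᵘ (ℚ.↥ q) 0
      cancel q@record{} = ℚᵘ.*≡* (≡.trans (ℤ.*-identityʳ (ℚ.↥ q ℤ.* ℚ.↧ q))
        (cong (ℚ.↥ q ℤ.*_) (≡.sym (ℤ.*-identityʳ (ℚ.↧ q)))))

    ≤-ℕ : ∀ q → Σ[ n ∈ ℕ ] q ℚ.≤ + n ℚ./ 1
    ≤-ℕ q = ℤ.∣ ℚ.↥ q ∣ , ℚ.toℚᵘ-cancel-≤ (ℚᵘ.≤-respʳ-≃ (ℚᵘ.≃-sym (/1≃ (+ ℤ.∣ ℚ.↥ q ∣))) (numerator q))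
      where
      numerator : ∀ q → ℚ.toℚᵘ q ℚᵘ.≤ ℚᵘ.mkℚᵘ (+ ℤ.∣ ℚ.↥ q ∣) 0
      numerator (ℚ.mkℚ (+ n) d _) = ℚᵘ.*≤* (ℤ.*-monoˡ-≤-nonNeg (+ n) (ℤ.+≤+ (ℕ.s≤s ℕ.z≤n)))
      numerator (ℚ.mkℚ -[1+ n ] d _) = ℚᵘ.*≤* ℤ.-≤+

    0</1 : ∀ n → 0ℚ ℚ.< + suc n ℚ./ 1
    0</1 n = ℚ.positive⁻¹ (+ suc n ℚ./ 1) {{ℚ.normalize-pos (suc n) 1}}

open IntegersInℚ

-- The field theory is done over an abstract ordered ring: in ℝ itself, comparing two elements would
-- unfold Cauchy sequences.  Zero and one are fromℤ (+ 0) and fromℤ (+ 1), so that they are the constants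
-- of the ring solver.
record RealLine : Set₁ where
  infix  8 -_
  infixl 7 _*_
  infixl 6 _+_
  infix  4 _≈_
  field
    Carrier : Set
    _≈_     : Carrier → Carrier → Set
    _+_ _*_ : Carrier → Carrier → Carrier
    -_      : Carrier → Carrier
    fromℤ   : ℤ → Carrier
    isCommutativeRing : IsCommutativeRing _≈_ _+_ _*_ -_ (fromℤ (+ 0)) (fromℤ (+ 1))

  commutativeRing : CommutativeRing 0ℓ 0ℓ
  commutativeRing = record { isCommutativeRing = isCommutativeRing }

  open CommutativeRing commutativeRing public
    hiding (Carrier; _≈_; _+_; _*_; -_; zero; isCommutativeRing)

  field
    fromℤ-+   : ∀ k l → fromℤ (k ℤ.+ l) ≈ fromℤ k + fromℤ l
    fromℤ-*   : ∀ k l → fromℤ (k ℤ.* l) ≈ fromℤ k * fromℤ l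
    fromℤ-neg : ∀ k → fromℤ (ℤ.- k) ≈ - fromℤ k

    ι     : ℚ → Carrier
    ι-/1  : ∀ k → ι (k ℚ./ 1) ≈ fromℤ k
    ι-+   : ∀ p q → ι (p ℚ.+ q) ≈ ι p + ι q
    ι-*   : ∀ p q → ι (p ℚ.* q) ≈ ι p * ι q
    ι-neg : ∀ p → ι (ℚ.- p) ≈ - ι p

    Pos         : Carrier → Set
    Pos-resp    : ∀ {x y} → x ≈ y → Pos x → Pos y
    Pos-+       : ∀ {x y} → Pos x → Pos y → Pos (x + y)
    Pos-*       : ∀ {x y} → Pos x → Pos y → Pos (x * y)
    Pos-ι       : ∀ {q} → 0ℚ ℚ.< q → Pos (ι q)
    Pos-ι⁻¹     : ∀ {q} → Pos (ι q) → 0ℚ ℚ.< q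
    -- The constructive substitute for trichotomy: sign decisions about general elements go through
    -- it.
    cotrans     : ∀ x y → Pos (x + y) → Pos x ⊎ Pos y
    archimedean : ∀ x → Σ[ q ∈ ℚ ] Pos (ι q + - x)
    infinitesimal⇒≈0 : ∀ x → (∀ ε → 0ℚ ℚ.< ε → Pos (ι ε + - x) × Pos (ι ε + x)) → x ≈ 0#

-- Order and signs on an abstract real line.

module RealLineTheory (L : RealLine) where

  open RealLine L
  open import Algebra.Properties.CommutativeMonoid.Sum +-commutativeMonoid using (sum; sum-cong-≋; sum-remove)
  open import Algebra.Solver.Ring.AlmostCommutativeRing using (fromCommutativeRing; _-Raw-AlmostCommutative⟶_)
  open import Relation.Binary.Reasoning.Setoid setoid

  ℤ⟶L : ℤ.+-*-rawRing -Raw-AlmostCommutative⟶ fromCommutativeRing commutativeRing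
  ℤ⟶L = record
    { ⟦_⟧    = fromℤ
    ; +-homo = fromℤ-+
    ; *-homo = fromℤ-*
    ; -‿homo = fromℤ-neg
    ; 0-homo = refl
    ; 1-homo = refl
    }

  coefficient≟ : ∀ k l → Maybe (fromℤ k ≈ fromℤ l)
  coefficient≟ k l with k ℤ.≟ l
  ... | yes k≡l = just (reflexive (cong fromℤ k≡l))
  ... | no  _   = nothing

  open import Algebra.Solver.Ring ℤ.+-*-rawRing (fromCommutativeRing commutativeRing) ℤ⟶L coefficient≟
    using (Polynomial; solve; _:+_; _:*_; _:-_; :-_; con; _:=_)

  ι-0 : ι 0ℚ ≈ 0#
  ι-0 = ι-/1 (+ 0)

  ι-1 : ι 1ℚ ≈ 1#
  ι-1 = ι-/1 (+ 1)

  #0 #1 : ∀ {n} → Polynomial n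
  #0 = con (+ 0)
  #1 = con (+ 1)

  Pos-1 : Pos 1#
  Pos-1 = Pos-resp ι-1 (Pos-ι (0</1 0))

  Pos-suc : ∀ n → Pos (fromℤ (+ suc n))
  Pos-suc n = Pos-resp (ι-/1 (+ suc n)) (Pos-ι (0</1 n))

  ¬Pos-0 : ¬ Pos 0#
  ¬Pos-0 h = ℚ.<-irrefl ≡.refl (Pos-ι⁻¹ (Pos-resp (sym ι-0) h))

  Pos-asym : ∀ {x} → Pos x → ¬ Pos (- x)
  Pos-asym {x} h k = ¬Pos-0 (Pos-resp (-‿inverseʳ x) (Pos-+ h k))

  Pos⇒≉0 : ∀ {x} → Pos x → ¬ x ≈ 0#
  Pos⇒≉0 h x≈0 = ¬Pos-0 (Pos-resp x≈0 h)

  -Pos⇒≉0 : ∀ {x} → Pos (- x) → ¬ x ≈ 0#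
  -Pos⇒≉0 {x} h x≈0 = ¬Pos-0 (Pos-resp (trans (-‿cong x≈0) (solve 0 (:- #0 := #0) refl)) h)

  -- Applied to ε = (ε - x) + x and ε = (ε + x) - x, cotransitivity leaves only -ε < x < ε, for
  -- every ε. Equations can thus be proved by refutation.
  tight : ∀ {x} → ¬ Pos x → ¬ Pos (- x) → x ≈ 0#
  tight {x} ¬x>0 ¬x<0 = infinitesimal⇒≈0 x λ ε ε>0 →
      [ (λ h → h) , (λ h → contradiction h ¬x>0) ]′
        (cotrans (ι ε + - x) x (Pos-resp (solve 2 (λ e x → e := (e :- x) :+ x) refl (ι ε) x) (Pos-ι ε>0)))
    , [ (λ h → h) , (λ h → contradiction h ¬x<0) ]′
        (cotrans (ι ε + x) (- x) (Pos-resp (solve 2 (λ e x → e := (e :+ x) :- x) refl (ι ε) x) (Pos-ι ε>0)))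

  -- A mere negation suffices for `x` because the conclusion is an equation: a sign of `y` would
  -- exclude both signs of `x`, and `tight` would make `x` zero.
  cancel-nonzero : ∀ {x y} → x * y ≈ 0# → ¬ x ≈ 0# → y ≈ 0#
  cancel-nonzero {x} {y} xy≈0 x≉0 = tight
    (λ y>0 → x≉0 (tight (λ x>0 → Pos⇒≉0 (Pos-* x>0 y>0) xy≈0)
                        (λ x<0 → -Pos⇒≉0 (Pos-resp (solve 2 (λ x y → :- x :* y := :- (x :* y)) refl x y) (Pos-* x<0 y>0)) xy≈0)))
    (λ y<0 → x≉0 (tight (λ x>0 → -Pos⇒≉0 (Pos-resp (solve 2 (λ x y → x :* :- y := :- (x :* y)) refl x y) (Pos-* x>0 y<0)) xy≈0)
                        (λ x<0 → Pos⇒≉0 (Pos-resp (solve 2 (λ x y → :- x :* :- y := x :* y) refl x y) (Pos-* x<0 y<0)) xy≈0)))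

  ¬Pos-neg-square : ∀ w → ¬ Pos (- (w * w))
  ¬Pos-neg-square w h = -Pos⇒≉0 h (trans (*-cong w≈0 w≈0) (solve 0 (#0 :* #0 := #0) refl))
    where
    w≈0 : w ≈ 0#
    w≈0 = tight
      (λ w>0 → Pos-asym (Pos-* w>0 w>0) h)
      (λ w<0 → Pos-asym (Pos-* w<0 w<0) (Pos-resp (solve 1 (λ w → :- (w :* w) := :- (:- w :* :- w)) refl w) h))

  -- In the splitting x = (x + w²) - w² the second summand is never positive.
  Pos-+-square : ∀ {x} w → Pos x → Pos (x + w * w)
  Pos-+-square {x} w h =
    [ (λ k → k) , (λ k → contradiction k (¬Pos-neg-square w)) ]′
      (cotrans (x + w * w) (- (w * w)) (Pos-resp (solve 2 (λ x y → x := (x :+ y) :- y) refl x (w * w)) h))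

  -- The product of the two positive quantities would be -(xyz)². Sign information passes between
  -- square multiples of `x` without the sign of `x` being determined.
  square-multiples-agree : ∀ {x} y z → Pos (x * (y * y)) → ¬ Pos (- (x * (z * z)))
  square-multiples-agree {x} y z h k = ¬Pos-neg-square (x * y * z)
    (Pos-resp (solve 3 (λ x y z → (x :* (y :* y)) :* :- (x :* (z :* z)) := :- ((x :* y :* z) :* (x :* y :* z))) refl x y z)
      (Pos-* h k))

  Pos-half : ∀ {x} → Pos (x + x) → Pos x
  Pos-half {x} h = [ (λ k → k) , (λ k → k) ]′ (cotrans x x h)

  infix 4 ∣_∣<_
  ∣_∣<_ : Carrier → Carrier → Set
  ∣ x ∣< m = Pos (m + - x) × Pos (m + x)

  ∣∣<-resp : ∀ {x y m n} → x ≈ y → m ≈ n → ∣ x ∣< m → ∣ y ∣< n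
  ∣∣<-resp x≈y m≈n (h , k) = Pos-resp (+-cong m≈n (-‿cong x≈y)) h , Pos-resp (+-cong m≈n x≈y) k

  -- Twice mn - xy, and twice mn + xy, is a sum of two products of the positive factors m ± x and n
  -- ± y.
  ∣∣<-* : ∀ {x y m n} → ∣ x ∣< m → ∣ y ∣< n → ∣ x * y ∣< m * n
  ∣∣<-* {x} {y} {m} {n} (h , k) (h′ , k′) =
      Pos-half (Pos-resp (solve 4 (λ x y m n →
        (m :- x) :* (n :+ y) :+ (m :+ x) :* (n :- y) := (m :* n :- x :* y) :+ (m :* n :- x :* y)) refl x y m n)
        (Pos-+ (Pos-* h k′) (Pos-* k h′)))
    , Pos-half (Pos-resp (solve 4 (λ x y m n →
        (m :- x) :* (n :- y) :+ (m :+ x) :* (n :+ y) := (m :* n :+ x :* y) :+ (m :* n :+ x :* y)) refl x y m n)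
        (Pos-+ (Pos-* h h′) (Pos-* k k′)))

  Pos-third : ∀ {x} → Pos (x + x + x) → Pos x
  Pos-third {x} h = [ Pos-half , (λ k → k) ]′ (cotrans (x + x) x h)

  Pos-+-ℕ : ∀ {x} n → Pos x → Pos (x + fromℤ (+ n))
  Pos-+-ℕ {x} zero    h = Pos-resp (solve 1 (λ x → x := x :+ #0) refl x) h
  Pos-+-ℕ     (suc n) h = Pos-+ h (Pos-suc n)

  difference : ∀ {p q} → p ℚ.< q → Pos (ι q + - ι p)
  difference {p} {q} p<q = Pos-resp (trans (ι-+ q (ℚ.- p)) (+-congˡ (ι-neg p)))
    (Pos-ι (subst (ℚ._< q ℚ.- p) (ℚ.+-inverseʳ p) (ℚ.+-monoˡ-< (ℚ.- p) p<q)))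

  bounded : ∀ x → Σ[ n ∈ ℕ ] ∣ x ∣< fromℤ (+ n)
  bounded x with archimedean x | archimedean (- x)
  ... | p , p-x>0 | q , q+x>0 with ≤-ℕ p | ≤-ℕ q
  ... | m , p≤m | n , q≤n = m ℕ.+ n
      , Pos-resp (trans (solve 3 (λ m n x → m :- x :+ n := m :+ n :- x) refl (fromℤ (+ m)) (fromℤ (+ n)) x)
                        (+-congʳ (sym (fromℤ-+ (+ m) (+ n)))))
          (Pos-+-ℕ n (widen m p≤m p-x>0))
      , Pos-resp (trans (solve 3 (λ m n x → n :- (:- x) :+ m := m :+ n :+ x) refl (fromℤ (+ m)) (fromℤ (+ n)) x)
                        (+-congʳ (sym (fromℤ-+ (+ m) (+ n)))))
          (Pos-+-ℕ m (widen n q≤n q+x>0))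
    where
    widen : ∀ {p y} n → p ℚ.≤ + n ℚ./ 1 → Pos (ι p + y) → Pos (fromℤ (+ n) + y)
    widen {p} {y} n p≤q h with ℚ.<-cmp p (+ n ℚ./ 1)
    ... | tri≈ _ p≡q _ = Pos-resp (+-congʳ (trans (reflexive (cong ι p≡q)) (ι-/1 (+ n)))) h
    ... | tri> _ _ q<p = contradiction (ℚ.<-≤-trans q<p p≤q) (ℚ.<-irrefl ≡.refl)
    ... | tri< p<q _ _ = Pos-resp (trans (solve 3 (λ p q y → (q :- p) :+ (p :+ y) := q :+ y) refl (ι p) (ι (+ n ℚ./ 1)) y)
                                         (+-congʳ (ι-/1 (+ n))))
                           (Pos-+ (difference p<q) h)

  ι-injective : ∀ {p q} → ι p ≈ ι q → p ≡ q
  ι-injective {p} {q} ιp≈ιq with ℚ.<-cmp p q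
  ... | tri≈ _ p≡q _ = p≡q
  ... | tri< p<q _ _ = contradiction (trans (+-congʳ (sym ιp≈ιq)) (-‿inverseʳ (ι p))) (Pos⇒≉0 (difference p<q))
  ... | tri> _ _ q<p = contradiction (trans (+-congʳ ιp≈ιq) (-‿inverseʳ (ι q))) (Pos⇒≉0 (difference q<p))

  -- Rational and integral elements, and rounding.

  Rational : Pred Carrier 0ℓ
  Rational x = Σ[ q ∈ ℚ ] x ≈ ι q

  Integral : Pred Carrier 0ℓ
  Integral x = Σ[ k ∈ ℤ ] x ≈ fromℤ k

  Irrational : Pred Carrier 0ℓ
  Irrational x = ∀ q → ¬ x ≈ ι q

  infixl 6 _⊕_ _⊖_ _⊞_ _⊟_
  infixl 7 _⊗_ _⊠_

  -- The circled operations build certificates of rationality, and the boxed ones certificates of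
  -- integrality, by repeating the shape of the expression certified.
  _⊕_ : ∀ {x y} → Rational x → Rational y → Rational (x + y)
  (p , x≈p) ⊕ (q , y≈q) = p ℚ.+ q , trans (+-cong x≈p y≈q) (sym (ι-+ p q))

  _⊗_ : ∀ {x y} → Rational x → Rational y → Rational (x * y)
  (p , x≈p) ⊗ (q , y≈q) = p ℚ.* q , trans (*-cong x≈p y≈q) (sym (ι-* p q))

  neg-ℚ : ∀ {x} → Rational x → Rational (- x)
  neg-ℚ (p , x≈p) = ℚ.- p , trans (-‿cong x≈p) (sym (ι-neg p))

  _⊖_ : ∀ {x y} → Rational x → Rational y → Rational (x + - y)
  r ⊖ s = r ⊕ neg-ℚ s

  rational : ∀ q → Rational (ι q)
  rational q = q , refl

  _⊞_ : ∀ {x y} → Integral x → Integral y → Integral (x + y)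
  (k , x≈k) ⊞ (l , y≈l) = k ℤ.+ l , trans (+-cong x≈k y≈l) (sym (fromℤ-+ k l))

  _⊠_ : ∀ {x y} → Integral x → Integral y → Integral (x * y)
  (k , x≈k) ⊠ (l , y≈l) = k ℤ.* l , trans (*-cong x≈k y≈l) (sym (fromℤ-* k l))

  neg-ℤ : ∀ {x} → Integral x → Integral (- x)
  neg-ℤ (k , x≈k) = ℤ.- k , trans (-‿cong x≈k) (sym (fromℤ-neg k))

  _⊟_ : ∀ {x y} → Integral x → Integral y → Integral (x + - y)
  r ⊟ s = r ⊞ neg-ℤ s

  integer : ∀ k → Integral (fromℤ k)
  integer k = k , refl

  integral⇒rational : ∀ {x} → Integral x → Rational x
  integral⇒rational (k , x≈k) = k ℚ./ 1 , trans x≈k (sym (ι-/1 k))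

  -- This is the test behind the case distinctions of the linear algebra below; for general elements
  -- there is none.
  rational≈0? : ∀ {x} → Rational x → Dec (x ≈ 0#)
  rational≈0? (q , x≈q) with q ℚ.≟ 0ℚ
  ... | yes ≡.refl = yes (trans x≈q ι-0)
  ... | no  q≢0    = no λ x≈0 → q≢0 (ι-injective (trans (sym x≈q) (trans x≈0 (sym ι-0))))

  reciprocal : ∀ {x} → Rational x → ¬ x ≈ 0# → Σ[ y ∈ Carrier ] Rational y × x * y ≈ 1#
  reciprocal (q , x≈q) x≉0 = ι 1/q , rational 1/q
    , trans (*-congʳ x≈q) (trans (sym (ι-* q 1/q)) (trans (reflexive (cong ι (ℚ.*-inverseʳ q {{q≢0}}))) ι-1))
    where
    q≢0 : ℚ.NonZero q
    q≢0 = ℚ.≢-nonZero {q} λ { ≡.refl → x≉0 (trans x≈q ι-0) }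
    1/q : ℚ
    1/q = ℚ.1/_ q {{q≢0}}

  solve-linear : ∀ {a y b} → Rational a → ¬ a ≈ 0# → a * y ≈ b → Σ[ e ∈ Carrier ] Rational e × y ≈ e * b
  solve-linear {a} {y} {b} ra a≉0 ay≈b with reciprocal ra a≉0
  ... | e , re , ae≈1 = e , re , (begin
    y             ≈⟨ solve 1 (λ y → y := #1 :* y) refl y ⟩
    1# * y        ≈⟨ *-congʳ ae≈1 ⟨
    (a * e) * y   ≈⟨ solve 3 (λ a e y → (a :* e) :* y := e :* (a :* y)) refl a e y ⟩
    e * (a * y)   ≈⟨ *-congˡ ay≈b ⟩
    e * b         ∎)

  clear-denominator : ∀ {x} → Rational x → Σ[ d ∈ Carrier ] Integral d × ¬ d ≈ 0# × Integral (d * x)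
  clear-denominator {x} (ℚ.mkℚ n d c , x≈q) = fromℤ (+ suc d) , integer (+ suc d)
    , Pos⇒≉0 (Pos-suc d)
    , n , (begin
      fromℤ (+ suc d) * x          ≈⟨ *-comm (fromℤ (+ suc d)) x ⟩
      x * fromℤ (+ suc d)          ≈⟨ *-cong x≈q (sym (ι-/1 (+ suc d))) ⟩
      ι q * ι (+ suc d ℚ./ 1)      ≈⟨ ι-* q (+ suc d ℚ./ 1) ⟨
      ι (q ℚ.* (+ suc d ℚ./ 1))    ≈⟨ reflexive (cong ι (*-denominator q)) ⟩
      ι (n ℚ./ 1)                  ≈⟨ ι-/1 n ⟩
      fromℤ n                      ∎)
    where
    q : ℚ
    q = ℚ.mkℚ n d c

  -- The tolerance 2/3 exceeds 1/2, so that the stopping condition and the condition for moving on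
  -- overlap and an approximate comparison can choose between them.
  round : ∀ z → Σ[ k ∈ Carrier ] Integral k × ∣ (z + - k) * fromℤ (+ 3) ∣< fromℤ (+ 2)
  round z with bounded z
  ... | m , z<m , -m<z = search (m ℕ.+ m) (- fromℤ (+ m)) (neg-ℤ (integer (+ m)))
    (Pos-resp (solve 2 (λ m z → (m :+ z) :+ (m :+ z) :+ (m :+ z) :+ con (+ 2) := con (+ 2) :+ (z :- (:- m)) :* con (+ 3)) refl (fromℤ (+ m)) z)
      (Pos-+-ℕ 2 (Pos-+ (Pos-+ -m<z -m<z) -m<z)))
    (Pos-resp (trans (solve 2 (λ m z → (m :- z) :+ (m :- z) :+ (m :- z) :+ con (+ 2) := con (+ 2) :- (z :- (:- m)) :* con (+ 3) :+ (m :+ m) :* con (+ 3)) refl (fromℤ (+ m)) z)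
                     (+-congˡ (*-congʳ (sym (fromℤ-+ (+ m) (+ m))))))
      (Pos-+-ℕ 2 (Pos-+ (Pos-+ z<m z<m) z<m)))
    where
    -- Invariant: -2/3 < z - k < 2/3 + n.
    search : ∀ n k → Integral k →
             Pos (fromℤ (+ 2) + (z + - k) * fromℤ (+ 3)) →
             Pos (fromℤ (+ 2) + - ((z + - k) * fromℤ (+ 3)) + fromℤ (+ n) * fromℤ (+ 3)) →
             Σ[ k ∈ Carrier ] Integral k × ∣ (z + - k) * fromℤ (+ 3) ∣< fromℤ (+ 2)
    search zero k ik lower upper = k , ik , Pos-resp (solve 2 (λ z k → con (+ 2) :- (z :- k) :* con (+ 3) :+ #0 :* con (+ 3) := con (+ 2) :- (z :- k) :* con (+ 3)) refl z k) upper , lower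
    -- The terms 2 - 3(z - k) and 3(z - k) - 1 sum to 1. Either z - k < 2/3 and the search ends, or
    -- z - k > 1/3, that is z - (k + 1) > -2/3, and it moves on.
    search (suc n) k ik lower upper with
      cotrans (fromℤ (+ 2) + - ((z + - k) * fromℤ (+ 3))) ((z + - k) * fromℤ (+ 3) + - fromℤ (+ 1))
        (Pos-resp (solve 2 (λ z k → #1 := (con (+ 2) :- (z :- k) :* con (+ 3)) :+ ((z :- k) :* con (+ 3) :- #1)) refl z k) Pos-1)
    ... | inj₁ close = k , ik , close , lower
    ... | inj₂ far   = search n (k + fromℤ (+ 1)) (ik ⊞ integer (+ 1))
      (Pos-resp (solve 2 (λ z k → (z :- k) :* con (+ 3) :- #1 := con (+ 2) :+ (z :- (k :+ #1)) :* con (+ 3)) refl z k) far)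
      (Pos-resp (trans (+-congˡ (*-congʳ (fromℤ-+ (+ 1) (+ n))))
        (solve 3 (λ z k n → con (+ 2) :- (z :- k) :* con (+ 3) :+ (#1 :+ n) :* con (+ 3) := con (+ 2) :- (z :- (k :+ #1)) :* con (+ 3) :+ n :* con (+ 3)) refl z k (fromℤ (+ n))))
        upper)

  positive-reciprocal : ∀ q → 0ℚ ℚ.< q → Σ[ e ∈ Carrier ] Pos e × e * ι q ≈ 1#
  positive-reciprocal q q>0 = ι 1/q , Pos-ι (ℚ.positive⁻¹ 1/q {{ℚ.1/pos⇒pos q {{ℚ.positive q>0}}}})
    , trans (sym (ι-* 1/q q)) (trans (reflexive (cong ι (ℚ.*-inverseˡ q {{q≢0}}))) ι-1)
    where
    q≢0 : ℚ.NonZero q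
    q≢0 = ℚ.pos⇒nonZero q {{ℚ.positive q>0}}
    1/q : ℚ
    1/q = ℚ.1/_ q {{q≢0}}

  -- A bound m on the inverse keeps `x` out of (-1/m, 1/m), where xy would be less than 1. Comparing
  -- `x` and `- x` with 1/m then decides the sign.
  apart : ∀ {x y} → x * y ≈ 1# → Pos x ⊎ Pos (- x)
  apart {x} {y} xy≈1 = decide
    (cotrans x (e + - x) (Pos-resp (solve 2 (λ e x → e := x :+ (e :- x)) refl e x) (proj₁ (proj₂ inverse))))
    (cotrans (- x) (e + x) (Pos-resp (solve 2 (λ e x → e := (:- x) :+ (e :+ x)) refl e x) (proj₁ (proj₂ inverse))))
    where
    n : ℕ
    n = proj₁ (bounded y)
    inverse = positive-reciprocal (+ suc n ℚ./ 1) (0</1 n)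
    e m : Carrier
    e = proj₁ inverse
    m = fromℤ (+ suc n)
    widen : ∀ y → Pos (fromℤ (+ n) + y) → Pos (m + y)
    widen y h = Pos-resp (trans (solve 2 (λ n y → n :+ y :+ #1 := (#1 :+ n) :+ y) refl (fromℤ (+ n)) y)
                                (+-congʳ (sym (fromℤ-+ (+ 1) (+ n)))))
                         (Pos-+ h Pos-1)
    decide : Pos x ⊎ Pos (e + - x) → Pos (- x) ⊎ Pos (e + x) → Pos x ⊎ Pos (- x)
    decide (inj₁ x>0) _           = inj₁ x>0
    decide (inj₂ _)   (inj₁ x<0)  = inj₂ x<0
    decide (inj₂ x<e) (inj₂ -e<x) = ⊥-elim (Pos⇒≉0
      (proj₁ (∣∣<-* (x<e , -e<x) (widen (- y) (proj₁ (proj₂ (bounded y))) , widen y (proj₂ (proj₂ (bounded y))))))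
      (trans (+-cong (trans (*-congˡ (sym (ι-/1 (+ suc n)))) (proj₂ (proj₂ inverse))) (-‿cong xy≈1)) (-‿inverseʳ 1#)))

  -- Linear dependence over ℚ.

  combination : ∀ {n} → Vector ℚ n → Vector Carrier n → Carrier
  combination c x = sum (λ i → ι (c i) * x i)

  combination-linear : ∀ {n} a b (p q : Vector ℚ n) x →
    combination (λ i → a ℚ.* p i ℚ.- b ℚ.* q i) x ≈ ι a * combination p x + - (ι b * combination q x)
  combination-linear {zero} a b p q x = solve 2 (λ a b → #0 := a :* #0 :- b :* #0) refl (ι a) (ι b)
  combination-linear {suc n} a b p q x = trans
    (+-cong (*-congʳ (sym (proj₂ ((rational a ⊗ rational (p 0F)) ⊖ (rational b ⊗ rational (q 0F))))))
            (combination-linear a b (λ i → p (suc i)) (λ i → q (suc i)) (λ i → x (suc i))))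
    (solve 7 (λ a b p q x s t → (a :* p :- b :* q) :* x :+ (a :* s :- b :* t) := a :* (p :* x :+ s) :- b :* (q :* x :+ t)) refl
      (ι a) (ι b) (ι (p 0F)) (ι (q 0F)) (x 0F) _ _)

  -- Turns a relation among the reduced vectors into one among the original ones: all multiples of
  -- the pivot vector `y` collect into the single coefficient s.
  substitute : ∀ {n} a (y : Carrier) (c r : Vector ℚ n) x → Σ[ s ∈ ℚ ]
    combination c (λ i → ι a * x i + - (ι (r i) * y)) ≈ ι s * y + combination (λ i → c i ℚ.* a) x
  substitute {zero} a y c r x = 0ℚ , trans (solve 1 (λ y → #0 := #0 :* y :+ #0) refl y) (+-congʳ (*-congʳ (sym ι-0)))
  substitute {suc n} a y c r x with substitute a y (λ i → c (suc i)) (λ i → r (suc i)) (λ i → x (suc i))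
  ... | s , eq = s ℚ.- c 0F ℚ.* r 0F , (begin
    ι (c 0F) * (ι a * x 0F + - (ι (r 0F) * y)) + combination (λ i → c (suc i)) (λ i → ι a * x (suc i) + - (ι (r (suc i)) * y))
      ≈⟨ +-congˡ eq ⟩
    ι (c 0F) * (ι a * x 0F + - (ι (r 0F) * y)) + (ι s * y + t)
      ≈⟨ solve 7 (λ c a x r y s t → c :* (a :* x :- r :* y) :+ (s :* y :+ t) := (s :- c :* r) :* y :+ ((c :* a) :* x :+ t)) refl
           (ι (c 0F)) (ι a) (x 0F) (ι (r 0F)) y (ι s) t ⟩
    (ι s + - (ι (c 0F) * ι (r 0F))) * y + ((ι (c 0F) * ι a) * x 0F + t)
      ≈⟨ +-cong (*-congʳ (proj₂ (rational s ⊖ (rational (c 0F) ⊗ rational (r 0F)))))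
                (+-congʳ (*-congʳ (proj₂ (rational (c 0F) ⊗ rational a)))) ⟩
    ι (s ℚ.- c 0F ℚ.* r 0F) * y + (ι (c 0F ℚ.* a) * x 0F + t) ∎)
    where
    t : Carrier
    t = combination (λ i → c (suc i) ℚ.* a) (λ i → x (suc i))

  *-nonzero : ∀ {p q} → p ≢ 0ℚ → q ≢ 0ℚ → p ℚ.* q ≢ 0ℚ
  *-nonzero {p} {q} p≢0 q≢0 pq≡0 = q≢0 (ι-injective (trans (cancel-nonzero
    (trans (sym (ι-* p q)) (trans (reflexive (cong ι pq≡0)) ι-0))
    (λ ιp≈0 → p≢0 (ι-injective (trans ιp≈0 (sym ι-0))))) (sym ι-0)))

  Dependent : ∀ {n} → Vector Carrier n → Set
  Dependent {n} x = Σ[ c ∈ Vector ℚ n ] (∃ λ i → c i ≢ 0ℚ) × combination c x ≈ 0#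

  -- Fraction-free Gaussian elimination.
  dependent : ∀ n (b : Vector Carrier n) (x : Vector Carrier (suc n)) →
              (∀ i → Σ[ q ∈ Vector ℚ n ] x i ≈ combination q b) → Dependent x
  dependent zero b x span = (λ _ → 1ℚ) , (0F , λ ())
    , trans (+-congʳ (*-cong ι-1 (proj₂ (span 0F)))) (solve 0 (#1 :* #0 :+ #0 := #0) refl)
  dependent (suc n) b x span with any? (λ i → ¬? (proj₁ (span i) 0F ℚ.≟ 0ℚ))
  ... | no ¬pivot = shift (dependent n (λ j → b (suc j)) (λ i → x (suc i)) (λ i →
      (λ j → proj₁ (span (suc i)) (suc j)) , trans (proj₂ (span (suc i))) (drop (suc i))))
    where
    drop : ∀ i → combination (proj₁ (span i)) b ≈ combination (λ j → proj₁ (span i) (suc j)) (λ j → b (suc j))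
    drop i = trans
      (+-congʳ (*-congʳ (trans (reflexive (cong ι (decidable-stable (proj₁ (span i) 0F ℚ.≟ 0ℚ) (λ ≢0 → ¬pivot (i , ≢0))))) ι-0)))
      (solve 2 (λ b t → #0 :* b :+ t := t) refl (b 0F) _)
    shift : Dependent (λ i → x (suc i)) → Dependent x
    shift (c , (i , ci≢0) , eq) = 0ℚ ∷ c , (suc i , ci≢0)
      , trans (+-cong (*-congʳ ι-0) eq) (solve 1 (λ x → #0 :* x :+ #0 := #0) refl (x 0F))
  -- Cross-multiplying with vector `i` removes `b 0F` from all the others. Undoing this scales their
  -- coefficients by the nonzero pivot, so the relation stays nontrivial.
  ... | yes (i , pivot≢0) = extend (dependent n (λ j → b (suc j))
          (λ k → ι pivot * x (punchIn i k) + - (ι (v (punchIn i k) 0F) * x i))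
          (λ k → (λ j → pivot ℚ.* v (punchIn i k) (suc j) ℚ.- v (punchIn i k) 0F ℚ.* v i (suc j)) , eliminate (punchIn i k)))
    where
    v : Vector (Vector ℚ (suc n)) (suc (suc n))
    v j = proj₁ (span j)
    pivot : ℚ
    pivot = v i 0F
    eliminate : ∀ k → ι pivot * x k + - (ι (v k 0F) * x i) ≈
                combination (λ j → pivot ℚ.* v k (suc j) ℚ.- v k 0F ℚ.* v i (suc j)) (λ j → b (suc j))
    eliminate k = begin
      ι pivot * x k + - (ι (v k 0F) * x i)
        ≈⟨ +-cong (*-congˡ (proj₂ (span k))) (-‿cong (*-congˡ (proj₂ (span i)))) ⟩
      ι pivot * (ι (v k 0F) * b 0F + s k) + - (ι (v k 0F) * (ι pivot * b 0F + s i))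
        ≈⟨ solve 5 (λ p q b s t → p :* (q :* b :+ s) :- q :* (p :* b :+ t) := p :* s :- q :* t) refl (ι pivot) (ι (v k 0F)) (b 0F) (s k) (s i) ⟩
      ι pivot * s k + - (ι (v k 0F) * s i)
        ≈⟨ combination-linear pivot (v k 0F) (λ j → v k (suc j)) (λ j → v i (suc j)) (λ j → b (suc j)) ⟨
      combination (λ j → pivot ℚ.* v k (suc j) ℚ.- v k 0F ℚ.* v i (suc j)) (λ j → b (suc j)) ∎
      where
      s : Fin (suc (suc n)) → Carrier
      s k = combination (λ j → v k (suc j)) (λ j → b (suc j))
    extend : Dependent (λ k → ι pivot * x (punchIn i k) + - (ι (v (punchIn i k) 0F) * x i)) → Dependent x
    extend (c , (k , ck≢0) , eq) = d
      , (punchIn i k , λ d≡0 → *-nonzero {c k} {pivot} ck≢0 pivot≢0 (≡.trans (≡.sym (d-others k)) d≡0)) , (begin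
      combination d x
        ≈⟨ sum-remove {i = i} (λ j → ι (d j) * x j) ⟩
      ι (d i) * x i + sum (λ k → ι (d (punchIn i k)) * x (punchIn i k))
        ≈⟨ +-cong (*-congʳ (reflexive (cong ι d-pivot))) (sum-cong-≋ (λ k → *-congʳ {x (punchIn i k)} (reflexive (cong ι (d-others k))))) ⟩
      ι s * x i + combination w (λ k → x (punchIn i k))
        ≈⟨ proj₂ substituted ⟨
      combination c (λ k → ι pivot * x (punchIn i k) + - (ι (v (punchIn i k) 0F) * x i))
        ≈⟨ eq ⟩
      0# ∎)
      where
      substituted = substitute pivot (x i) c (λ k → v (punchIn i k) 0F) (λ k → x (punchIn i k))
      s : ℚ
      s = proj₁ substituted
      w : Vector ℚ (suc n)
      w k = c k ℚ.* pivot
      d : Vector ℚ (suc (suc n))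
      d = insertAt w i s
      d-pivot : d i ≡ s
      d-pivot = insertAt-lookup w i s
      d-others : ∀ k → d (punchIn i k) ≡ w k
      d-others = insertAt-punchIn w i s

  -- Rationals in a subfield, the sign of the discriminant, and the reflection 1 - α.

  subfield-contains-ℚ : ∀ {ℓ} (P : Pred Carrier ℓ) →
    (∀ {x y} → x ≈ y → x ∈ P → y ∈ P) → 1# ∈ P →
    (∀ {x y} → x ∈ P → y ∈ P → x + y ∈ P) → (∀ {x y} → x ∈ P → y ∈ P → x * y ∈ P) →
    (∀ {x} → x ∈ P → - x ∈ P) → (∀ {x y} → x ∈ P → x * y ≈ 1# → y ∈ P) →
    ∀ q → ι q ∈ P
  subfield-contains-ℚ P P-resp P-1 P-+ P-* P-neg P-inverse q = P-resp (sym q≈)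
    (P-* (P-integral (proj₂ (proj₂ (proj₂ cleared)))) (P-inverse (P-integral (proj₁ (proj₂ cleared))) (proj₂ (proj₂ inverted))))
    where
    cleared = clear-denominator (rational q)
    d : Carrier
    d = proj₁ cleared
    inverted = reciprocal (integral⇒rational (proj₁ (proj₂ cleared))) (proj₁ (proj₂ (proj₂ cleared)))
    q≈ : ι q ≈ (d * ι q) * proj₁ inverted
    q≈ = trans (sym (*-identityʳ (ι q))) (trans (*-congˡ (sym (proj₂ (proj₂ inverted))))
      (solve 3 (λ q d e → q :* (d :* e) := (d :* q) :* e) refl (ι q) d (proj₁ inverted)))
    P-ℕ : ∀ n → fromℤ (+ n) ∈ P
    P-ℕ zero    = P-resp (-‿inverseʳ 1#) (P-+ P-1 (P-neg P-1))
    P-ℕ (suc n) = P-resp (sym (fromℤ-+ (+ 1) (+ n))) (P-+ P-1 (P-ℕ n))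
    P-integral : ∀ {x} → Integral x → x ∈ P
    P-integral (+ n      , x≈) = P-resp (sym x≈) (P-ℕ n)
    P-integral (-[1+ n ] , x≈) = P-resp (sym (trans x≈ (fromℤ-neg (+ suc n)))) (P-neg (P-ℕ (suc n)))

  Pos-integral? : ∀ {x} → Integral x → Dec (Pos x)
  Pos-integral? (+ zero   , x≈) = no  λ h → ¬Pos-0 (Pos-resp x≈ h)
  Pos-integral? (+ suc n  , x≈) = yes (Pos-resp (sym x≈) (Pos-suc n))
  Pos-integral? (-[1+ n ] , x≈) = no  λ h → Pos-asym (Pos-suc n) (Pos-resp (trans x≈ (fromℤ-neg (+ suc n))) h)

  Pos-discriminant? : ∀ {p q} → Integral p → Integral q → Dec (Pos (fromℤ (+ 4) * p * p * p + fromℤ (+ 27) * q * q))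
  Pos-discriminant? p∈ℤ q∈ℤ = Pos-integral? (integer (+ 4) ⊠ p∈ℤ ⊠ p∈ℤ ⊠ p∈ℤ ⊞ integer (+ 27) ⊠ q∈ℤ ⊠ q∈ℤ)

  -- The nested products are what `α ^ 3` and `α ^ 2` unfold to.
  cubic-without-square-term : ∀ {α n d} → α * α * α + fromℤ n * α + fromℤ d ≈ 0# →
    α * (α * (α * 1#)) + fromℤ (+ 0) * (α * (α * 1#)) + fromℤ n * α + fromℤ d ≈ 0#
  cubic-without-square-term {α} {n} {d} = trans
    (solve 3 (λ α n d → α :* (α :* (α :* #1)) :+ #0 :* (α :* (α :* #1)) :+ n :* α :+ d := α :* α :* α :+ n :* α :+ d)
       refl α (fromℤ n) (fromℤ d))

  -- Substituting α = 1 - β and changing the sign to make the cubic monic again gives these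
  -- coefficients.
  reflected-cubic : ∀ {α n d} → α * α * α + fromℤ n * α + fromℤ d ≈ 0# →
    let β = 1# + - α in
    β * (β * (β * 1#)) + fromℤ (ℤ.- (+ 3)) * (β * (β * 1#)) + fromℤ (+ 3 ℤ.+ n) * β + fromℤ (ℤ.- (+ 1 ℤ.+ n ℤ.+ d)) ≈ 0#
  reflected-cubic {α} {n} {d} root = trans
    (+-cong (+-congˡ (*-congʳ (fromℤ-+ (+ 3) n)))
      (trans (fromℤ-neg _) (-‿cong (trans (fromℤ-+ _ d) (+-congʳ (fromℤ-+ (+ 1) n))))))
    (trans (solve 3 (λ α n d → let β = #1 :- α in
        β :* (β :* (β :* #1)) :+ con -[1+ 2 ] :* (β :* (β :* #1)) :+ (con (+ 3) :+ n) :* β :- (#1 :+ n :+ d)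
          := :- (α :* α :* α :+ n :* α :+ d)) refl α (fromℤ n) (fromℤ d))
      (trans (-‿cong root) (solve 0 (:- #0 := #0) refl)))

  reflected-irrational : ∀ {α} → Irrational α → Irrational (1# + - α)
  reflected-irrational {α} α∉ℚ q eq = α∉ℚ _ (trans (solve 1 (λ α → α := #1 :- (#1 :- α)) refl α)
    (trans (+-congˡ (-‿cong eq)) (proj₂ (integral⇒rational (integer (+ 1)) ⊖ rational q))))

  reflected-positive : ∀ {α} → Pos α → Pos (1# + - (1# + - α))
  reflected-positive {α} = Pos-resp (solve 1 (λ α → α := #1 :- (#1 :- α)) refl α)

  -- Linear algebra in a cubic field.

  module CubicField
    {ℓ} (K : Pred Carrier ℓ)
    (K-resp : ∀ {x y} → x ≈ y → x ∈ K → y ∈ K)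
    (K-+ : ∀ {x y} → x ∈ K → y ∈ K → x + y ∈ K)
    (K-* : ∀ {x y} → x ∈ K → y ∈ K → x * y ∈ K)
    (K-neg : ∀ {x} → x ∈ K → - x ∈ K)
    (K-ι : ∀ q → ι q ∈ K)
    (b : Vector Carrier 3) (b∈K : ∀ i → b i ∈ K)
    (b-independent : ∀ q → combination q b ≈ 0# → ∀ i → q i ≡ 0ℚ)
    (b-spanning : ∀ x → x ∈ K → Σ[ q ∈ Vector ℚ 3 ] x ≈ combination q b)
    where

    K-rational : ∀ {x} → Rational x → x ∈ K
    K-rational (q , x≈q) = K-resp (sym x≈q) (K-ι q)

    K-1 : 1# ∈ K
    K-1 = K-rational (integral⇒rational (integer (+ 1)))

    -- Equality modulo a relation `p`: the ring solver checks a polynomial identity in which `u` is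
    -- the explicit cofactor of `p`.
    modulo : ∀ {x y p} u → x ≈ y + u * p → p ≈ 0# → x ≈ y
    modulo {x} {y} {p} u eq p≈0 = trans eq (trans (+-congˡ (*-congˡ p≈0)) (solve 2 (λ y u → y :+ u :* #0 := y) refl y u))

    modulo₂ : ∀ {x y p q} u v → x ≈ y + u * p + v * q → p ≈ 0# → q ≈ 0# → x ≈ y
    modulo₂ u v eq p≈0 q≈0 = modulo u (modulo v eq q≈0) p≈0

    dependent₄ : ∀ {w x y z} → w ∈ K → x ∈ K → y ∈ K → z ∈ K → Σ[ c ∈ Vector ℚ 4 ]
      ¬ (∀ i → ι (c i) ≈ 0#) × ι (c 0F) * w + ι (c 1F) * x + ι (c 2F) * y + ι (c 3F) * z ≈ 0#
    dependent₄ {w} {x} {y} {z} w∈K x∈K y∈K z∈K = extract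
      (dependent 3 b (w ∷ x ∷ y ∷ z ∷ []) λ where
        0F → b-spanning w w∈K
        1F → b-spanning x x∈K
        2F → b-spanning y y∈K
        3F → b-spanning z z∈K)
      where
      extract : Dependent (w ∷ x ∷ y ∷ z ∷ []) → _
      extract (c , (i , ci≢0) , eq) = c , (λ all≈0 → ci≢0 (ι-injective (trans (all≈0 i) (sym ι-0))))
        , trans (solve 8 (λ a b c d w x y z → a :* w :+ b :* x :+ c :* y :+ d :* z := a :* w :+ (b :* x :+ (c :* y :+ (d :* z :+ #0)))) refl
                  (ι (c 0F)) (ι (c 1F)) (ι (c 2F)) (ι (c 3F)) w x y z) eq

    -- A nonzero `s` would present `x` as the rational -r/s.
    independent₂ : ∀ {x r s} → Irrational x → Rational r → Rational s → r + s * x ≈ 0# → r ≈ 0# × s ≈ 0#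
    independent₂ {x} {r} {s} x∉ℚ r∈ℚ s∈ℚ eq = cases (rational≈0? s∈ℚ)
      where
      cases : Dec (s ≈ 0#) → r ≈ 0# × s ≈ 0#
      cases (yes s≈0) = modulo₂ 1# (- x) (solve 3 (λ r s x → r := #0 :+ #1 :* (r :+ s :* x) :+ (:- x) :* s) refl r s x) eq s≈0 , s≈0
      cases (no s≉0) =
        let e , e∈ℚ , x≈ = solve-linear s∈ℚ s≉0 (modulo 1# (solve 3 (λ r s x → s :* x := :- r :+ #1 :* (r :+ s :* x)) refl r s x) eq)
        in contradiction (trans x≈ (proj₂ (e∈ℚ ⊗ neg-ℚ r∈ℚ))) (x∉ℚ _)

    affine-irrational : ∀ {x r s} → Irrational x → Rational r → Rational s → ¬ s ≈ 0# → Irrational (s * x + r)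
    affine-irrational {x} {r} {s} x∉ℚ r∈ℚ s∈ℚ s≉0 q eq = s≉0 (proj₂ (independent₂ x∉ℚ (r∈ℚ ⊖ rational q) s∈ℚ
      (modulo 1# (solve 4 (λ r s x q → r :- q :+ s :* x := #0 :+ #1 :* ((s :* x :+ r) :- q)) refl r s x (ι q))
        (trans (+-congʳ eq) (-‿inverseʳ (ι q))))))

    module _ {x} (x∈K : x ∈ K) (x∉ℚ : Irrational x) where

      module _ {a b′} (a∈ℚ : Rational a) (b∈ℚ : Rational b′) (quadratic : x * x + - (a + b′ * x) ≈ 0#) where

        -- The four elements 1, x, y, xy are dependent, so (k₂ + k₃x)y = -(k₀ + k₁x), and dividing
        -- inside the quadratic field ℚ(x) puts y into ℚ + ℚx.
        decompose : ∀ {y} → y ∈ K → Σ[ r ∈ ℚ ] Σ[ s ∈ ℚ ] y ≈ ι r + ι s * x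
        decompose {y} y∈K = proj₁ r∈ℚ , proj₁ s∈ℚ , (begin
            y                                  ≈⟨ proj₂ (proj₂ solution) ⟩
            e * (r + s * x)                    ≈⟨ solve 4 (λ e r s x → e :* (r :+ s :* x) := e :* r :+ (e :* s) :* x) refl e r s x ⟩
            e * r + (e * s) * x                ≈⟨ +-cong (proj₂ r∈ℚ) (*-congʳ (proj₂ s∈ℚ)) ⟩
            ι (proj₁ r∈ℚ) + ι (proj₁ s∈ℚ) * x  ∎)
          where
          relation = dependent₄ K-1 x∈K y∈K (K-* x∈K y∈K)
          k : Fin 4 → Carrier
          k i = ι (proj₁ relation i)
          k∈ℚ : ∀ i → Rational (k i)
          k∈ℚ i = rational (proj₁ relation i)
          m ν r s : Carrier
          -- The other root of the quadratic is b′ - x, so m - k₃x is the conjugate of k₂ + k₃x.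
          m = k 2F + k 3F * b′
          ν = k 2F * m + - (k 3F * k 3F * a)
          r = - (k 0F * m + - (k 1F * k 3F * a))
          s = - (k 1F * m + - (k 0F * k 3F) + - (k 1F * k 3F * b′))
          m∈ℚ : Rational m
          m∈ℚ = k∈ℚ 2F ⊕ k∈ℚ 3F ⊗ b∈ℚ
          ν∈ℚ : Rational ν
          ν∈ℚ = k∈ℚ 2F ⊗ m∈ℚ ⊖ k∈ℚ 3F ⊗ k∈ℚ 3F ⊗ a∈ℚ
          k₂k₃≉0 : k 2F ≈ 0# → k 3F ≈ 0# → ⊥
          k₂k₃≉0 k₂≈0 k₃≈0 = proj₁ (proj₂ relation) (λ where
              0F → proj₁ k₀k₁≈0
              1F → proj₂ k₀k₁≈0
              2F → k₂≈0
              3F → k₃≈0)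
            where
            k₀k₁≈0 : k 0F ≈ 0# × k 1F ≈ 0#
            k₀k₁≈0 = independent₂ x∉ℚ (k∈ℚ 0F) (k∈ℚ 1F) (trans
              (modulo₂ (- y) (- (x * y))
                (solve 6 (λ k₀ k₁ k₂ k₃ x y → k₀ :+ k₁ :* x :=
                   (k₀ :* #1 :+ k₁ :* x :+ k₂ :* y :+ k₃ :* (x :* y)) :+ (:- y) :* k₂ :+ (:- (x :* y)) :* k₃)
                   refl (k 0F) (k 1F) (k 2F) (k 3F) x y)
                k₂≈0 k₃≈0)
              (proj₂ (proj₂ relation)))
          denominator≉0 : ¬ k 2F + k 3F * x ≈ 0#
          denominator≉0 eq = let k₂≈0 , k₃≈0 = independent₂ x∉ℚ (k∈ℚ 2F) (k∈ℚ 3F) eq in k₂k₃≉0 k₂≈0 k₃≈0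
          conjugate≉0 : ¬ m + - k 3F * x ≈ 0#
          conjugate≉0 eq =
            let m≈0 , -k₃≈0 = independent₂ x∉ℚ m∈ℚ (neg-ℚ (k∈ℚ 3F)) eq
                k₃≈0 = modulo (- 1#) (solve 1 (λ k → k := #0 :+ (:- #1) :* (:- k)) refl (k 3F)) -k₃≈0
                k₂≈0 = modulo₂ 1# (- b′) (solve 3 (λ k₂ k₃ b → k₂ := #0 :+ #1 :* (k₂ :+ k₃ :* b) :+ (:- b) :* k₃) refl (k 2F) (k 3F) b′) m≈0 k₃≈0
            in k₂k₃≉0 k₂≈0 k₃≈0
          ν≉0 : ¬ ν ≈ 0#
          ν≉0 ν≈0 = conjugate≉0 (cancel-nonzero (modulo₂ 1# (- (k 3F * k 3F))
            (solve 5 (λ k₂ k₃ a b x → (k₂ :+ k₃ :* x) :* ((k₂ :+ k₃ :* b) :+ (:- k₃) :* x) :=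
               #0 :+ #1 :* (k₂ :* (k₂ :+ k₃ :* b) :- k₃ :* k₃ :* a) :+ (:- (k₃ :* k₃)) :* (x :* x :- (a :+ b :* x)))
               refl (k 2F) (k 3F) a b′ x)
            ν≈0 quadratic) denominator≉0)
          -- k₂ + k₃x is cleared from the relation by multiplying with its conjugate, of which ν is the norm.
          solution : Σ[ e ∈ Carrier ] Rational e × y ≈ e * (r + s * x)
          solution = solve-linear ν∈ℚ ν≉0 (modulo₂ (m + - (k 3F * x)) (k 3F * k 3F * y + k 1F * k 3F)
            (solve 8 (λ k₀ k₁ k₂ k₃ a b x y →
               let m = k₂ :+ k₃ :* b in
               (k₂ :* m :- k₃ :* k₃ :* a) :* y :=
               (:- (k₀ :* m :- k₁ :* k₃ :* a) :+ (:- (k₁ :* m :- k₀ :* k₃ :- k₁ :* k₃ :* b)) :* x)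
                 :+ (m :- k₃ :* x) :* (k₀ :* #1 :+ k₁ :* x :+ k₂ :* y :+ k₃ :* (x :* y))
                 :+ (k₃ :* k₃ :* y :+ k₁ :* k₃) :* (x :* x :- (a :+ b :* x)))
               refl (k 0F) (k 1F) (k 2F) (k 3F) a b′ x y)
            (proj₂ (proj₂ relation)) quadratic)
          e : Carrier
          e = proj₁ solution
          r∈ℚ : Rational (e * r)
          r∈ℚ = proj₁ (proj₂ solution) ⊗ neg-ℚ (k∈ℚ 0F ⊗ m∈ℚ ⊖ k∈ℚ 1F ⊗ k∈ℚ 3F ⊗ a∈ℚ)
          s∈ℚ : Rational (e * s)
          s∈ℚ = proj₁ (proj₂ solution) ⊗ neg-ℚ (k∈ℚ 1F ⊗ m∈ℚ ⊖ k∈ℚ 0F ⊗ k∈ℚ 3F ⊖ k∈ℚ 1F ⊗ k∈ℚ 3F ⊗ b∈ℚ)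

        -- Otherwise K = ℚ + ℚx would have dimension 2.
        ¬quadratic : ⊥
        ¬quadratic = refute (dependent 2 (1# ∷ x ∷ []) b λ i →
          let r , s , bᵢ≈ = decompose (b∈K i) in
          (r ∷ s ∷ []) , trans bᵢ≈ (solve 3 (λ r s x → r :+ s :* x := r :* #1 :+ (s :* x :+ #0)) refl (ι r) (ι s) x))
          where
          refute : Dependent b → ⊥
          refute (c , (i , cᵢ≢0) , eq) = cᵢ≢0 (b-independent c eq i)

      -- A nonzero `c` would make `x` quadratic.
      independent₃ : ∀ {a b c} → Rational a → Rational b → Rational c →
                     a + b * x + c * (x * x) ≈ 0# → a ≈ 0# × b ≈ 0# × c ≈ 0#
      independent₃ {a} {b} {c} a∈ℚ b∈ℚ c∈ℚ eq with rational≈0? c∈ℚ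
      ... | yes c≈0 =
        let a≈0 , b≈0 = independent₂ x∉ℚ a∈ℚ b∈ℚ
              (modulo₂ 1# (- (x * x)) (solve 4 (λ a b c x → a :+ b :* x := #0 :+ #1 :* (a :+ b :* x :+ c :* (x :* x)) :+ (:- (x :* x)) :* c) refl a b c x) eq c≈0)
        in a≈0 , b≈0 , c≈0
      ... | no c≉0 =
        let e , e∈ℚ , x²≈ = solve-linear c∈ℚ c≉0
              (modulo 1# (solve 4 (λ a b c x → c :* (x :* x) := :- (a :+ b :* x) :+ #1 :* (a :+ b :* x :+ c :* (x :* x))) refl a b c x) eq)
        in ⊥-elim (¬quadratic (e∈ℚ ⊗ neg-ℚ a∈ℚ) (e∈ℚ ⊗ neg-ℚ b∈ℚ)
             (trans (+-congʳ x²≈) (solve 4 (λ e a b x → e :* (:- (a :+ b :* x)) :- (e :* (:- a) :+ (e :* (:- b)) :* x) := #0) refl e a b x)))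

      -- In a relation among 1, x, x², y the coefficient of y cannot vanish, since 1, x, x² are
      -- independent.
      span₃ : ∀ {y} → y ∈ K → Σ[ a ∈ ℚ ] Σ[ b ∈ ℚ ] Σ[ c ∈ ℚ ] y ≈ ι a + ι b * x + ι c * (x * x)
      span₃ {y} y∈K = coefficient (rational≈0? (k∈ℚ 3F))
        where
        relation = dependent₄ K-1 x∈K (K-* x∈K x∈K) y∈K
        k : Fin 4 → Carrier
        k i = ι (proj₁ relation i)
        k∈ℚ : ∀ i → Rational (k i)
        k∈ℚ i = rational (proj₁ relation i)
        coefficient : Dec (k 3F ≈ 0#) → Σ[ a ∈ ℚ ] Σ[ b ∈ ℚ ] Σ[ c ∈ ℚ ] y ≈ ι a + ι b * x + ι c * (x * x)
        coefficient (yes k₃≈0) = ⊥-elim (proj₁ (proj₂ relation) (λ where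
            0F → proj₁ zeros
            1F → proj₁ (proj₂ zeros)
            2F → proj₂ (proj₂ zeros)
            3F → k₃≈0))
          where
          zeros = independent₃ (k∈ℚ 0F) (k∈ℚ 1F) (k∈ℚ 2F) (modulo₂ 1# (- y)
            (solve 6 (λ k₀ k₁ k₂ k₃ x y → k₀ :+ k₁ :* x :+ k₂ :* (x :* x) :=
               #0 :+ #1 :* (k₀ :* #1 :+ k₁ :* x :+ k₂ :* (x :* x) :+ k₃ :* y) :+ (:- y) :* k₃)
               refl (k 0F) (k 1F) (k 2F) (k 3F) x y)
            (proj₂ (proj₂ relation)) k₃≈0)
        coefficient (no k₃≉0) =
          let e , e∈ℚ , y≈ = solve-linear (k∈ℚ 3F) k₃≉0 (modulo 1#
                (solve 6 (λ k₀ k₁ k₂ k₃ x y → k₃ :* y := :- (k₀ :+ k₁ :* x :+ k₂ :* (x :* x))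
                   :+ #1 :* (k₀ :* #1 :+ k₁ :* x :+ k₂ :* (x :* x) :+ k₃ :* y))
                   refl (k 0F) (k 1F) (k 2F) (k 3F) x y)
                (proj₂ (proj₂ relation)))
              a , a≈ = e∈ℚ ⊗ neg-ℚ (k∈ℚ 0F)
              b , b≈ = e∈ℚ ⊗ neg-ℚ (k∈ℚ 1F)
              c , c≈ = e∈ℚ ⊗ neg-ℚ (k∈ℚ 2F)
          in a , b , c , trans y≈ (trans
               (solve 5 (λ e k₀ k₁ k₂ x → e :* (:- (k₀ :+ k₁ :* x :+ k₂ :* (x :* x))) :=
                  e :* (:- k₀) :+ (e :* (:- k₁)) :* x :+ (e :* (:- k₂)) :* (x :* x)) refl e (k 0F) (k 1F) (k 2F) x)
               (+-cong (+-cong a≈ (*-congʳ b≈)) (*-congʳ c≈)))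

      -- Every y is a rational polynomial in x of degree at most two; this is why irrational
      -- elements are primitive.
      generates : ∀ {ℓ′} (P : Pred Carrier ℓ′) → (∀ {y z} → y ≈ z → y ∈ P → z ∈ P) →
        (∀ {y z} → y ∈ P → z ∈ P → y + z ∈ P) → (∀ {y z} → y ∈ P → z ∈ P → y * z ∈ P) →
        (∀ q → ι q ∈ P) → x ∈ P → ∀ {y} → y ∈ K → y ∈ P
      generates P P-resp P-+ P-* P-ι x∈P y∈K =
        let a , b , c , y≈ = span₃ y∈K
        in P-resp (sym y≈) (P-+ (P-+ (P-ι a) (P-* (P-ι b) x∈P)) (P-* (P-ι c) (P-* x∈P x∈P)))

      -- From x³ = a + bx + cx² follows x(x² - cx - b) = a, with a ≠ 0 by independence of 1, x, x².
      -- A rational y would turn xy = 1 into a relation between 1 and x.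
      inverse : Σ[ y ∈ Carrier ] y ∈ K × Irrational y × x * y ≈ 1#
      inverse = invert (span₃ (K-* x∈K (K-* x∈K x∈K)))
        where
        invert : Σ[ a ∈ ℚ ] Σ[ b ∈ ℚ ] Σ[ c ∈ ℚ ] x * (x * x) ≈ ι a + ι b * x + ι c * (x * x) →
                 Σ[ y ∈ Carrier ] y ∈ K × Irrational y × x * y ≈ 1#
        invert (a , b , c , x³≈) = y , y∈K , y∉ℚ , xy≈1
          where
          x≉0 : ¬ x ≈ 0#
          x≉0 x≈0 = x∉ℚ 0ℚ (trans x≈0 (sym ι-0))
          z : Carrier
          z = - ι b + - ι c * x + 1# * (x * x)
          xz≈a : x * z ≈ ι a
          xz≈a = modulo 1# (solve 4 (λ a b c x → x :* ((:- b) :+ (:- c) :* x :+ #1 :* (x :* x)) :=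
              a :+ #1 :* (x :* (x :* x) :- (a :+ b :* x :+ c :* (x :* x)))) refl (ι a) (ι b) (ι c) x)
            (trans (+-congʳ x³≈) (-‿inverseʳ _))
          a≉0 : ¬ ι a ≈ 0#
          a≉0 a≈0 = Pos⇒≉0 Pos-1 (proj₂ (proj₂ (independent₃ (neg-ℚ (rational b)) (neg-ℚ (rational c)) (integral⇒rational (integer (+ 1)))
            (cancel-nonzero (trans xz≈a a≈0) x≉0))))
          reciprocal-a = reciprocal (rational a) a≉0
          e y : Carrier
          e = proj₁ reciprocal-a
          y = e * z
          y∈K : y ∈ K
          y∈K = K-* (K-rational (proj₁ (proj₂ reciprocal-a)))
            (K-+ (K-+ (K-neg (K-ι b)) (K-* (K-neg (K-ι c)) x∈K)) (K-* K-1 (K-* x∈K x∈K)))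
          xy≈1 : x * y ≈ 1#
          xy≈1 = begin
            x * (e * z)   ≈⟨ solve 3 (λ x e z → x :* (e :* z) := (x :* z) :* e) refl x e z ⟩
            (x * z) * e   ≈⟨ *-congʳ xz≈a ⟩
            ι a * e       ≈⟨ proj₂ (proj₂ reciprocal-a) ⟩
            1#            ∎
          y∉ℚ : Irrational y
          y∉ℚ q y≈q = -Pos⇒≉0 (Pos-resp (solve 0 (#1 := :- con -[1+ 0 ]) refl) Pos-1)
            (proj₁ (independent₂ x∉ℚ (integral⇒rational (integer -[1+ 0 ])) (rational q)
              (trans (+-congˡ (trans (*-comm (ι q) x) (trans (*-congˡ (sym y≈q)) xy≈1))) (solve 0 (con -[1+ 0 ] :+ #1 := #0) refl))))

    -- Expand 1 in the basis with coefficients qᵢ. If bⱼ were a rational r, then bⱼ - r(q₀b₀ + q₁b₁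
    -- + q₂b₂) = 0 would be a relation. For q₀ = 0 it refutes j = 0, as b₀ has coefficient 1; for q₀
    -- ≠ 0 it refutes j = 1, as r = 0 is forced and b₁ then has coefficient 1.
    irrational-element : Σ[ x ∈ Carrier ] x ∈ K × Irrational x
    irrational-element = choose (b-spanning 1# K-1)
      where
      choose : Σ[ q ∈ Vector ℚ 3 ] 1# ≈ combination q b → Σ[ x ∈ Carrier ] x ∈ K × Irrational x
      choose (q , 1≈) = cases (q 0F ℚ.≟ 0ℚ)
        where
        1≈′ : ι (q 0F) * b 0F + (ι (q 1F) * b 1F + ι (q 2F) * b 2F) + - 1# ≈ 0#
        1≈′ = trans (+-congʳ (trans (solve 3 (λ x y z → x :+ (y :+ z) := x :+ (y :+ (z :+ #0))) refl
                       (ι (q 0F) * b 0F) (ι (q 1F) * b 1F) (ι (q 2F) * b 2F)) (sym 1≈)))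
                    (-‿inverseʳ 1#)
        independent-at : ∀ {x y z} → (x∈ℚ : Rational x) (y∈ℚ : Rational y) (z∈ℚ : Rational z) →
          x * b 0F + (y * b 1F + z * b 2F) ≈ 0# → x ≈ 0# × y ≈ 0#
        independent-at {x} {y} {z} (p , x≈) (r , y≈) (s , z≈) eq = at 0F x≈ , at 1F y≈
          where
          zero-combination : combination (p ∷ r ∷ s ∷ []) b ≈ 0#
          zero-combination = trans (+-cong (*-congʳ (sym x≈)) (+-cong (*-congʳ (sym y≈)) (+-congʳ (*-congʳ (sym z≈)))))
            (trans (solve 3 (λ x y z → x :+ (y :+ (z :+ #0)) := x :+ (y :+ z)) refl (x * b 0F) (y * b 1F) (z * b 2F)) eq)
          at : ∀ i {w} → w ≈ ι ((p ∷ r ∷ s ∷ []) i) → w ≈ 0#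
          at i w≈ = trans w≈ (trans (reflexive (cong ι (b-independent (p ∷ r ∷ s ∷ []) zero-combination i))) ι-0)
        cases : Dec (q 0F ≡ 0ℚ) → Σ[ x ∈ Carrier ] x ∈ K × Irrational x
        cases (yes q₀≡0) = b 0F , b∈K 0F , λ r b₀≈r → Pos⇒≉0 Pos-1
          (modulo₂ 1# (ι r) (solve 2 (λ r q₀ → #1 := #0 :+ #1 :* (#1 :- r :* q₀) :+ r :* q₀) refl (ι r) (ι (q 0F)))
            (proj₁ (independent-at
              (integral⇒rational (integer (+ 1)) ⊖ rational r ⊗ rational (q 0F))
              (neg-ℚ (rational r ⊗ rational (q 1F))) (neg-ℚ (rational r ⊗ rational (q 2F)))
              (modulo₂ 1# (- ι r)
                (solve 7 (λ r q₀ q₁ q₂ b₀ b₁ b₂ → (#1 :- r :* q₀) :* b₀ :+ ((:- (r :* q₁)) :* b₁ :+ (:- (r :* q₂)) :* b₂) :=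
                   #0 :+ #1 :* (b₀ :- r) :+ (:- r) :* (q₀ :* b₀ :+ (q₁ :* b₁ :+ q₂ :* b₂) :- #1))
                   refl (ι r) (ι (q 0F)) (ι (q 1F)) (ι (q 2F)) (b 0F) (b 1F) (b 2F))
                (trans (+-congʳ b₀≈r) (-‿inverseʳ (ι r))) 1≈′)))
            (trans (reflexive (cong ι q₀≡0)) ι-0))
        cases (no q₀≢0) = b 1F , b∈K 1F , λ r b₁≈r →
          let -rq₀≈0 , 1-rq₁≈0 = independent-at
                (neg-ℚ (rational r ⊗ rational (q 0F)))
                (integral⇒rational (integer (+ 1)) ⊖ rational r ⊗ rational (q 1F))
                (neg-ℚ (rational r ⊗ rational (q 2F)))
                (modulo₂ 1# (- ι r)
                  (solve 7 (λ r q₀ q₁ q₂ b₀ b₁ b₂ → (:- (r :* q₀)) :* b₀ :+ ((#1 :- r :* q₁) :* b₁ :+ (:- (r :* q₂)) :* b₂) :=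
                     #0 :+ #1 :* (b₁ :- r) :+ (:- r) :* (q₀ :* b₀ :+ (q₁ :* b₁ :+ q₂ :* b₂) :- #1))
                     refl (ι r) (ι (q 0F)) (ι (q 1F)) (ι (q 2F)) (b 0F) (b 1F) (b 2F))
                  (trans (+-congʳ b₁≈r) (-‿inverseʳ (ι r))) 1≈′)
              r≈0 = cancel-nonzero (modulo (- 1#) (solve 2 (λ r q₀ → q₀ :* r := #0 :+ (:- #1) :* (:- (r :* q₀))) refl (ι r) (ι (q 0F))) -rq₀≈0)
                      (λ q₀≈0 → q₀≢0 (ι-injective (trans q₀≈0 (sym ι-0))))
          in Pos⇒≉0 Pos-1 (modulo₂ 1# (ι (q 1F)) (solve 2 (λ r q₁ → #1 := #0 :+ #1 :* (#1 :- r :* q₁) :+ q₁ :* r) refl (ι r) (ι (q 1F))) 1-rq₁≈0 r≈0)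

    -- From kx³ = A + Bx + Cx² over ℤ, θ = 3kx - C is integral of trace 0.
    depressed-cubic : Σ[ θ ∈ Carrier ] θ ∈ K × Irrational θ ×
      Σ[ p ∈ Carrier ] Σ[ q ∈ Carrier ] Integral p × Integral q × θ * θ * θ + p * θ + q ≈ 0#
    depressed-cubic = depress irrational-element
      where
      depress : Σ[ x ∈ Carrier ] x ∈ K × Irrational x → _
      depress (x , x∈K , x∉ℚ) = clear (span₃ x∈K x∉ℚ (K-* x∈K (K-* x∈K x∈K)))
        where
        clear : Σ[ a ∈ ℚ ] Σ[ b ∈ ℚ ] Σ[ c ∈ ℚ ] x * (x * x) ≈ ι a + ι b * x + ι c * (x * x) → _
        clear (a , b , c , x³≈) =
          θ , K-+ (K-* (K-rational 3k∈ℚ) x∈K) (K-neg (K-rational (integral⇒rational C∈ℤ)))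
            , affine-irrational x∉ℚ (neg-ℚ (integral⇒rational C∈ℤ)) 3k∈ℚ 3k≉0
            -- Multiplying kx³ = A + Bx + Cx² by 27k² and putting 3kx = θ + C gives this p and the q
            -- below.
            , - (fromℤ (+ 9) * k * B) + - (fromℤ (+ 3) * C * C)
            , - (fromℤ (+ 2) * C * C * C) + - (fromℤ (+ 9) * k * C * B) + - (fromℤ (+ 27) * k * k * A)
            , neg-ℤ (integer (+ 9) ⊠ k∈ℤ ⊠ B∈ℤ) ⊟ integer (+ 3) ⊠ C∈ℤ ⊠ C∈ℤ
            , neg-ℤ (integer (+ 2) ⊠ C∈ℤ ⊠ C∈ℤ ⊠ C∈ℤ) ⊟ integer (+ 9) ⊠ k∈ℤ ⊠ C∈ℤ ⊠ B∈ℤ ⊟ integer (+ 27) ⊠ k∈ℤ ⊠ k∈ℤ ⊠ A∈ℤ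
            , modulo (fromℤ (+ 27) * k * k * k)
                (solve 7 (λ i j l a b c x →
                   let k = i :* j :* l
                       A = (i :* a) :* j :* l
                       B = i :* (j :* b) :* l
                       C = i :* j :* (l :* c)
                       θ = con (+ 3) :* k :* x :- C
                   in θ :* θ :* θ :+ (:- (con (+ 9) :* k :* B) :- con (+ 3) :* C :* C) :* θ
                        :+ (:- (con (+ 2) :* C :* C :* C) :- con (+ 9) :* k :* C :* B :- con (+ 27) :* k :* k :* A)
                      := #0 :+ con (+ 27) :* k :* k :* k :* (x :* (x :* x) :- (a :+ b :* x :+ c :* (x :* x))))
                   refl (proj₁ da) (proj₁ db) (proj₁ dc) (ι a) (ι b) (ι c) x)
                (trans (+-congʳ x³≈) (-‿inverseʳ _))
          where
          da = clear-denominator (rational a)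
          db = clear-denominator (rational b)
          dc = clear-denominator (rational c)
          k A B C θ : Carrier
          k = proj₁ da * proj₁ db * proj₁ dc
          A = (proj₁ da * ι a) * proj₁ db * proj₁ dc
          B = proj₁ da * (proj₁ db * ι b) * proj₁ dc
          C = proj₁ da * proj₁ db * (proj₁ dc * ι c)
          θ = fromℤ (+ 3) * k * x + - C
          k∈ℤ : Integral k
          k∈ℤ = proj₁ (proj₂ da) ⊠ proj₁ (proj₂ db) ⊠ proj₁ (proj₂ dc)
          A∈ℤ : Integral A
          A∈ℤ = proj₂ (proj₂ (proj₂ da)) ⊠ proj₁ (proj₂ db) ⊠ proj₁ (proj₂ dc)
          B∈ℤ : Integral B
          B∈ℤ = proj₁ (proj₂ da) ⊠ proj₂ (proj₂ (proj₂ db)) ⊠ proj₁ (proj₂ dc)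
          C∈ℤ : Integral C
          C∈ℤ = proj₁ (proj₂ da) ⊠ proj₁ (proj₂ db) ⊠ proj₂ (proj₂ (proj₂ dc))
          3k∈ℚ : Rational (fromℤ (+ 3) * k)
          3k∈ℚ = integral⇒rational (integer (+ 3) ⊠ k∈ℤ)
          3k≉0 : ¬ fromℤ (+ 3) * k ≈ 0#
          3k≉0 eq = proj₁ (proj₂ (proj₂ dc)) (cancel-nonzero (cancel-nonzero eq (Pos⇒≉0 (Pos-suc 2)) )
            (λ ij≈0 → proj₁ (proj₂ (proj₂ db)) (cancel-nonzero ij≈0 (proj₁ (proj₂ (proj₂ da))))))

    -- Embeddings into ℂ when 4p³ + 27q² is not positive.

    module Embedding
      (re im : Σ[ x ∈ Carrier ] x ∈ K → Carrier)
      (σ-cong : ∀ x y → proj₁ x ≈ proj₁ y → re x ≈ re y × im x ≈ im y)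
      (σ-+ : ∀ {x y} (x∈K : x ∈ K) (y∈K : y ∈ K) →
             re (x + y , K-+ x∈K y∈K) ≈ re (x , x∈K) + re (y , y∈K) ×
             im (x + y , K-+ x∈K y∈K) ≈ im (x , x∈K) + im (y , y∈K))
      (σ-* : ∀ {x y} (x∈K : x ∈ K) (y∈K : y ∈ K) →
             re (x * y , K-* x∈K y∈K) ≈ re (x , x∈K) * re (y , y∈K) + - (im (x , x∈K) * im (y , y∈K)) ×
             im (x * y , K-* x∈K y∈K) ≈ re (x , x∈K) * im (y , y∈K) + im (x , x∈K) * re (y , y∈K))
      (σ-neg : ∀ {x} (x∈K : x ∈ K) →
             re (- x , K-neg x∈K) ≈ - re (x , x∈K) × im (- x , K-neg x∈K) ≈ - im (x , x∈K))
      (σ-1 : re (1# , K-1) ≈ 1# × im (1# , K-1) ≈ 0#)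
      where

      infix 4 _↦_+i_
      -- The membership proof is packed into the relation, so that images of compound expressions
      -- can be computed without naming it; by `σ-cong` the image does not depend on it.
      _↦_+i_ : Carrier → Carrier → Carrier → Set _
      x ↦ s +i t = Σ[ x∈K ∈ x ∈ K ] re (x , x∈K) ≈ s × im (x , x∈K) ≈ t

      ↦-resp : ∀ {x y s t s′ t′} → x ≈ y → s ≈ s′ → t ≈ t′ → x ↦ s +i t → y ↦ s′ +i t′
      ↦-resp {x} {y} x≈y s≈s′ t≈t′ (x∈K , re≈ , im≈) = K-resp x≈y x∈K
        , trans (proj₁ congruent) (trans re≈ s≈s′) , trans (proj₂ congruent) (trans im≈ t≈t′)
        where
        congruent = σ-cong (y , K-resp x≈y x∈K) (x , x∈K) (sym x≈y)

      ↦-unique : ∀ {x s t s′ t′} → x ↦ s +i t → x ↦ s′ +i t′ → s ≈ s′ × t ≈ t′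
      ↦-unique {x} (h , re≈ , im≈) (h′ , re≈′ , im≈′) =
        trans (sym re≈) (trans (proj₁ congruent) re≈′) , trans (sym im≈) (trans (proj₂ congruent) im≈′)
        where
        congruent = σ-cong (x , h) (x , h′) refl

      ↦-+ : ∀ {x y s t s′ t′} → x ↦ s +i t → y ↦ s′ +i t′ → x + y ↦ s + s′ +i t + t′
      ↦-+ (h , re≈ , im≈) (h′ , re≈′ , im≈′) = K-+ h h′
        , trans (proj₁ (σ-+ h h′)) (+-cong re≈ re≈′) , trans (proj₂ (σ-+ h h′)) (+-cong im≈ im≈′)

      ↦-* : ∀ {x y s t s′ t′} → x ↦ s +i t → y ↦ s′ +i t′ → x * y ↦ s * s′ + - (t * t′) +i s * t′ + t * s′
      ↦-* (h , re≈ , im≈) (h′ , re≈′ , im≈′) = K-* h h′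
        , trans (proj₁ (σ-* h h′)) (+-cong (*-cong re≈ re≈′) (-‿cong (*-cong im≈ im≈′)))
        , trans (proj₂ (σ-* h h′)) (+-cong (*-cong re≈ im≈′) (*-cong im≈ re≈′))

      ↦-neg : ∀ {x s t} → x ↦ s +i t → - x ↦ - s +i - t
      ↦-neg (h , re≈ , im≈) = K-neg h , trans (proj₁ (σ-neg h)) (-‿cong re≈) , trans (proj₂ (σ-neg h)) (-‿cong im≈)

      ↦-1 : 1# ↦ 1# +i 0#
      ↦-1 = K-1 , σ-1

      ↦-ℕ : ∀ n → fromℤ (+ n) ↦ fromℤ (+ n) +i 0#
      ↦-ℕ zero    = ↦-resp (-‿inverseʳ 1#) (-‿inverseʳ 1#) (-‿inverseʳ 0#) (↦-+ ↦-1 (↦-neg ↦-1))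
      ↦-ℕ (suc n) = ↦-resp (sym (fromℤ-+ (+ 1) (+ n))) (sym (fromℤ-+ (+ 1) (+ n))) (+-identityˡ 0#) (↦-+ ↦-1 (↦-ℕ n))

      ↦-ℤ : ∀ k → fromℤ k ↦ fromℤ k +i 0#
      ↦-ℤ (+ n)    = ↦-ℕ n
      ↦-ℤ -[1+ n ] = ↦-resp (sym (fromℤ-neg (+ suc n))) (sym (fromℤ-neg (+ suc n))) (solve 0 (:- #0 := #0) refl)
                       (↦-neg (↦-ℕ (suc n)))

      ↦-integral : ∀ {x} → Integral x → x ↦ x +i 0#
      ↦-integral (k , x≈k) = ↦-resp (sym x≈k) (sym x≈k) refl (↦-ℤ k)

      -- With d a denominator of x, the image of x times d is the image of the integer dx, and d
      -- cancels.
      ↦-rational : ∀ {x} → Rational x → x ↦ x +i 0#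
      ↦-rational {x} x∈ℚ = x∈K
        , trans (solve 2 (λ r x → r := x :+ (r :- x)) refl r x) (trans (+-congˡ r-x≈0) (+-identityʳ x))
        , cancel-nonzero (trans (solve 3 (λ d r t → d :* t := d :* t :+ #0 :* r) refl d r t) (proj₂ values)) d≉0
        where
        cleared = clear-denominator x∈ℚ
        d : Carrier
        d = proj₁ cleared
        d≉0 = proj₁ (proj₂ (proj₂ cleared))
        x∈K : x ∈ K
        x∈K = K-rational x∈ℚ
        r t : Carrier
        r = re (x , x∈K)
        t = im (x , x∈K)
        values : d * r + - (0# * t) ≈ d * x × d * t + 0# * r ≈ 0#
        values = ↦-unique (↦-* (↦-integral (proj₁ (proj₂ cleared))) (x∈K , refl , refl))
                          (↦-integral (proj₂ (proj₂ (proj₂ cleared))))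
        r-x≈0 : r + - x ≈ 0#
        r-x≈0 = cancel-nonzero (trans (solve 4 (λ d r x t → d :* (r :- x) := (d :* r :- #0 :* t) :- d :* x) refl d r x t)
                          (trans (+-congʳ (proj₁ values)) (-‿inverseʳ (d * x)))) d≉0

      module _ {θ p q} (θ∈K : θ ∈ K) (θ∉ℚ : Irrational θ) (p∈ℤ : Integral p) (q∈ℤ : Integral q)
               (cubic : θ * θ * θ + p * θ + q ≈ 0#)
               (D≯0 : ¬ Pos (fromℤ (+ 4) * p * p * p + fromℤ (+ 27) * q * q)) where

        private
          s t : Carrier
          s = re (θ , θ∈K)
          t = im (θ , θ∈K)

          θ↦ : θ ↦ s +i t
          θ↦ = θ∈K , refl , refl

          -- Real and imaginary part of z³ + pz + q = 0 at z = s + it.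
          root : s * (s * s) + - (fromℤ (+ 3) * (s * (t * t))) + p * s + q ≈ 0# ×
                 t * (fromℤ (+ 3) * (s * s) + - (t * t) + p) ≈ 0#
          root = ↦-unique (↦-resp cubic
              (solve 4 (λ s t p q →
                 (((s :* s :- t :* t) :* s :- (s :* t :+ t :* s) :* t) :+ (p :* s :- #0 :* t)) :+ q
                 := s :* (s :* s) :- con (+ 3) :* (s :* (t :* t)) :+ p :* s :+ q) refl s t p q)
              (solve 3 (λ s t p →
                 (((s :* s :- t :* t) :* t :+ (s :* t :+ t :* s) :* s) :+ (p :* t :+ #0 :* s)) :+ #0
                 := t :* (con (+ 3) :* (s :* s) :- t :* t :+ p)) refl s t p)
              (↦-+ (↦-+ (↦-* (↦-* θ↦ θ↦) θ↦) (↦-* (↦-integral p∈ℤ) θ↦)) (↦-integral q∈ℤ)))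
            (↦-ℕ 0)

          -- The roots are s ± it and -2s, so minus their discriminant is 4p³ + 27q² = 4t²(t² + 9s²)².
          discriminant : Pos (t * t) → ¬ t ≈ 0# → Pos (fromℤ (+ 4) * p * p * p + fromℤ (+ 27) * q * q)
          discriminant t²>0 t≉0 = Pos-resp (sym D≈) (Pos-* (Pos-* (Pos-suc 3) t²>0) (Pos-* h h))
            where
            h : Pos (t * t + (fromℤ (+ 3) * s) * (fromℤ (+ 3) * s))
            h = Pos-+-square (fromℤ (+ 3) * s) t²>0
            p≈ : p ≈ t * t + - (fromℤ (+ 3) * (s * s))
            p≈ = modulo 1# (solve 3 (λ s t p → p := t :* t :- con (+ 3) :* (s :* s) :+ #1 :* (con (+ 3) :* (s :* s) :- t :* t :+ p)) refl s t p)
                   (cancel-nonzero (proj₂ root) t≉0)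
            q≈ : q ≈ fromℤ (+ 2) * (s * (s * s)) + fromℤ (+ 2) * (s * (t * t))
            q≈ = modulo₂ 1# (- s) (solve 4 (λ s t p q → q := con (+ 2) :* (s :* (s :* s)) :+ con (+ 2) :* (s :* (t :* t))
                     :+ #1 :* (s :* (s :* s) :- con (+ 3) :* (s :* (t :* t)) :+ p :* s :+ q)
                     :+ (:- s) :* (p :- (t :* t :- con (+ 3) :* (s :* s)))) refl s t p q)
                   (proj₁ root) (trans (+-congʳ p≈) (-‿inverseʳ _))
            D≈ : fromℤ (+ 4) * p * p * p + fromℤ (+ 27) * q * q ≈ (fromℤ (+ 4) * (t * t)) *
                 ((t * t + (fromℤ (+ 3) * s) * (fromℤ (+ 3) * s)) * (t * t + (fromℤ (+ 3) * s) * (fromℤ (+ 3) * s)))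
            D≈ = trans (+-cong (*-cong (*-cong (*-congˡ p≈) p≈) p≈) (*-cong (*-congˡ q≈) q≈))
              (solve 2 (λ s t →
                 let p = t :* t :- con (+ 3) :* (s :* s)
                     q = con (+ 2) :* (s :* (s :* s)) :+ con (+ 2) :* (s :* (t :* t))
                     h = t :* t :+ (con (+ 3) :* s) :* (con (+ 3) :* s)
                 in con (+ 4) :* p :* p :* p :+ con (+ 27) :* q :* q := (con (+ 4) :* (t :* t)) :* (h :* h)) refl s t)

          t≈0 : t ≈ 0#
          t≈0 = tight
            (λ t>0 → D≯0 (discriminant (Pos-* t>0 t>0) (Pos⇒≉0 t>0)))
            (λ t<0 → D≯0 (discriminant (Pos-resp (solve 1 (λ t → :- t :* :- t := t :* t) refl t) (Pos-* t<0 t<0)) (-Pos⇒≉0 t<0)))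

        -- The image of a + bθ + cθ² has imaginary part (b + 2cs)t, and t vanishes.
        real-image : ∀ x → im x ≈ 0#
        real-image (x , x∈K) = evaluate (span₃ θ∈K θ∉ℚ x∈K)
          where
          evaluate : Σ[ a ∈ ℚ ] Σ[ b ∈ ℚ ] Σ[ c ∈ ℚ ] x ≈ ι a + ι b * θ + ι c * (θ * θ) → im (x , x∈K) ≈ 0#
          evaluate (a , b , c , x≈) = trans
            (proj₂ (↦-unique (x∈K , refl , refl) (↦-resp (sym x≈) refl refl
              (↦-+ (↦-+ (↦-rational (rational a)) (↦-* (↦-rational (rational b)) θ↦)) (↦-* (↦-rational (rational c)) (↦-* θ↦ θ↦))))))
            (modulo (ι b + ι c * (fromℤ (+ 2) * s)) (solve 4 (λ b c s t →
                (#0 :+ (b :* t :+ #0 :* s)) :+ (c :* (s :* t :+ t :* s) :+ #0 :* (s :* s :- t :* t))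
                := #0 :+ (b :+ c :* (con (+ 2) :* s)) :* t) refl (ι b) (ι c) s t)
              t≈0)

    -- Small elements of the trace-zero lattice and their cubics.

    module SmallRoot {θ p q} (θ∈K : θ ∈ K) (θ∉ℚ : Irrational θ) (p∈ℤ : Integral p) (q∈ℤ : Integral q)
                     (cubic : θ * θ * θ + p * θ + q ≈ 0#)
                     (D>0 : Pos (fromℤ (+ 4) * p * p * p + fromℤ (+ 27) * q * q)) where

      -- The squares of the roots of X³ + pX + q sum to -2p, so 3θ² has trace -6p and the summand 2p
      -- cancels it.
      ω : Carrier
      ω = fromℤ (+ 3) * (θ * θ) + fromℤ (+ 2) * p

      ω∈K : ω ∈ K
      ω∈K = K-+ (K-* (K-rational (integral⇒rational (integer (+ 3)))) (K-* θ∈K θ∈K))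
                (K-rational (integral⇒rational (integer (+ 2) ⊠ p∈ℤ)))

      -- θ and ω = 3θ² + 2p are integral of trace 0.
      Λ : Pred Carrier 0ℓ
      Λ x = Σ[ u ∈ Carrier ] Σ[ v ∈ Carrier ] Integral u × Integral v × x ≈ u * θ + v * ω

      Λ-neg : ∀ {x} → x ∈ Λ → - x ∈ Λ
      Λ-neg (u , v , u∈ℤ , v∈ℤ , x≈) = - u , - v , neg-ℤ u∈ℤ , neg-ℤ v∈ℤ
        , trans (-‿cong x≈) (solve 4 (λ u v θ ω → :- (u :* θ :+ v :* ω) := :- u :* θ :+ :- v :* ω) refl u v θ ω)

      Λ⊆K : ∀ {x} → x ∈ Λ → x ∈ K
      Λ⊆K (u , v , u∈ℤ , v∈ℤ , x≈) = K-resp (sym x≈)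
        (K-+ (K-* (K-rational (integral⇒rational u∈ℤ)) θ∈K) (K-* (K-rational (integral⇒rational v∈ℤ)) ω∈K))

      -- If uθ + vω = r is rational, then (2pv - r) + uθ + 3vθ² = 0 forces u = v = 0.
      Λ-irrational : ∀ {x} → x ∈ Λ → ¬ x ≈ 0# → Irrational x
      Λ-irrational {x} (u , v , u∈ℤ , v∈ℤ , x≈) x≉0 r x≈r = x≉0 (trans x≈ (modulo₂ θ ω
          (solve 4 (λ u v θ ω → u :* θ :+ v :* ω := #0 :+ θ :* u :+ ω :* v) refl u v θ ω)
          (proj₁ (proj₂ zeros)) (cancel-nonzero (proj₂ (proj₂ zeros)) (Pos⇒≉0 (Pos-suc 2)))))
        where
        zeros = independent₃ θ∈K θ∉ℚ
          (integral⇒rational (v∈ℤ ⊠ (integer (+ 2) ⊠ p∈ℤ)) ⊖ rational r)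
          (integral⇒rational u∈ℤ) (integral⇒rational (integer (+ 3) ⊠ v∈ℤ))
          (trans (solve 5 (λ u v θ p r → (v :* (con (+ 2) :* p) :- r) :+ u :* θ :+ con (+ 3) :* v :* (θ :* θ)
                    := (u :* θ :+ v :* (con (+ 3) :* (θ :* θ) :+ con (+ 2) :* p)) :- r) refl u v θ p (ι r))
                 (trans (+-congʳ (trans (sym x≈) x≈r)) (-‿inverseʳ (ι r))))

      -- The continued fraction expansion of z, with nearest integers: x shrinks by the factor ∣z - k∣ < 2/3
      -- at each step.
      descend : ∀ n x z → ¬ x ≈ 0# → x ∈ Λ → x * z ∈ Λ → z ∈ K → Irrational z →
                ∣ x * fromℤ (+ 3) ∣< fromℤ (+ (2 ℕ.+ n)) →
                Σ[ x ∈ Carrier ] x ∈ Λ × ¬ x ≈ 0# × ∣ x * fromℤ (+ 3) ∣< fromℤ (+ 2)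
      descend zero x z x≉0 x∈Λ _ _ _ x<2 = x , x∈Λ , x≉0 , x<2
      descend (suc n) x z x≉0 x∈Λ xz∈Λ z∈K z∉ℚ x<n+3 =
        -- One Euclidean step: the pair (x, xz) of lattice elements becomes (xw, x), where xw = xz -
        -- kx is the remainder and z′ = 1/w the next complete quotient.
        descend n (x * w) z′ xw≉0 (remainder x∈Λ xz∈Λ) (Λ-resp (sym xwz′≈x) x∈Λ) z′∈K z′∉ℚ
          ( reduce y (proj₁ bound)
          , Pos-resp (+-congˡ (solve 1 (λ y → :- (:- y) := y) refl y))
              (reduce (- y) (Pos-resp (+-congˡ (solve 1 (λ y → y :* con (+ 3) := :- (:- y :* con (+ 3))) refl y)) (proj₂ bound))))
        where
        rounded = round z
        k w : Carrier
        k = proj₁ rounded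
        w = z + - k
        y : Carrier
        y = x * w * fromℤ (+ 3)
        w∈K : w ∈ K
        w∈K = K-+ z∈K (K-neg (K-rational (integral⇒rational (proj₁ (proj₂ rounded)))))
        w∉ℚ : Irrational w
        w∉ℚ r w≈r = z∉ℚ _ (trans (solve 2 (λ z k → z := (z :- k) :+ k) refl z k)
          (trans (+-congʳ w≈r) (proj₂ (rational r ⊕ integral⇒rational (proj₁ (proj₂ rounded))))))
        inverted = inverse w∈K w∉ℚ
        z′ = proj₁ inverted
        z′∈K = proj₁ (proj₂ inverted)
        z′∉ℚ = proj₁ (proj₂ (proj₂ inverted))
        xwz′≈x : x * w * z′ ≈ x
        xwz′≈x = trans (*-assoc x w z′) (trans (*-congˡ (proj₂ (proj₂ (proj₂ inverted)))) (*-identityʳ x))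
        xw≉0 : ¬ x * w ≈ 0#
        xw≉0 xw≈0 = w∉ℚ 0ℚ (trans (cancel-nonzero xw≈0 x≉0) (sym ι-0))
        Λ-resp : ∀ {x y} → x ≈ y → x ∈ Λ → y ∈ Λ
        Λ-resp x≈y (u , v , u∈ℤ , v∈ℤ , x≈) = u , v , u∈ℤ , v∈ℤ , trans (sym x≈y) x≈
        remainder : x ∈ Λ → x * z ∈ Λ → x * w ∈ Λ
        remainder (u , v , u∈ℤ , v∈ℤ , x≈) (u′ , v′ , u′∈ℤ , v′∈ℤ , xz≈) =
            u′ + - (k * u) , v′ + - (k * v)
          , u′∈ℤ ⊟ proj₁ (proj₂ rounded) ⊠ u∈ℤ , v′∈ℤ ⊟ proj₁ (proj₂ rounded) ⊠ v∈ℤ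
          , (begin
            x * (z + - k)                                    ≈⟨ solve 3 (λ x z k → x :* (z :- k) := x :* z :- k :* x) refl x z k ⟩
            x * z + - (k * x)                                ≈⟨ +-cong xz≈ (-‿cong (*-congˡ x≈)) ⟩
            u′ * θ + v′ * ω + - (k * (u * θ + v * ω))        ≈⟨ solve 7 (λ u v u′ v′ k θ ω → u′ :* θ :+ v′ :* ω :- k :* (u :* θ :+ v :* ω)
                                                                  := (u′ :- k :* u) :* θ :+ (v′ :- k :* v) :* ω) refl u v u′ v′ k θ ω ⟩
            (u′ + - (k * u)) * θ + (v′ + - (k * v)) * ω      ∎)
        bound : ∣ (x * w * fromℤ (+ 3)) * fromℤ (+ 3) ∣< (fromℤ (+ 3) + fromℤ (+ n)) * fromℤ (+ 2)
        bound = ∣∣<-resp (solve 2 (λ x w → (x :* con (+ 3)) :* (w :* con (+ 3)) := (x :* w :* con (+ 3)) :* con (+ 3)) refl x w)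
          (*-congʳ (fromℤ-+ (+ 3) (+ n))) (∣∣<-* x<n+3 (proj₂ (proj₂ rounded)))
        -- From 3y < 2(3 + n) follows y < 2 + n, because 2(3 + n) + n = 3(2 + n). The factor 2/3
        -- thus lowers the integer bound by one.
        reduce : ∀ y → Pos ((fromℤ (+ 3) + fromℤ (+ n)) * fromℤ (+ 2) + - (y * fromℤ (+ 3))) → Pos (fromℤ (+ (2 ℕ.+ n)) + - y)
        reduce y h = Pos-resp (+-congʳ (sym (fromℤ-+ (+ 2) (+ n)))) (Pos-third (Pos-resp
          (solve 2 (λ n y → (con (+ 3) :+ n) :* con (+ 2) :- y :* con (+ 3) :+ n :=
             (con (+ 2) :+ n :- y) :+ (con (+ 2) :+ n :- y) :+ (con (+ 2) :+ n :- y)) refl (fromℤ (+ n)) y)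
          (Pos-+-ℕ n h)))

      small-element : Σ[ x ∈ Carrier ] x ∈ Λ × ¬ x ≈ 0# × ∣ x * fromℤ (+ 3) ∣< fromℤ (+ 2)
      -- The initial pair (θ, θz) is (θ, ω). The bound on 3θ fixes the number of steps.
      small-element = descend n θ z θ≉0 θ∈Λ θz∈Λ (K-* ω∈K θ⁻¹∈K) z∉ℚ (widen (- (θ * fromℤ (+ 3))) (proj₁ (proj₂ initial)) , widen (θ * fromℤ (+ 3)) (proj₂ (proj₂ initial)))
        where
        inverted = inverse θ∈K θ∉ℚ
        θ⁻¹∈K = proj₁ (proj₂ inverted)
        initial = bounded (θ * fromℤ (+ 3))
        n : ℕ
        n = proj₁ initial
        z : Carrier
        z = ω * proj₁ inverted
        θz≈ω : θ * z ≈ ω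
        θz≈ω = modulo ω (solve 3 (λ θ ω e → θ :* (ω :* e) := ω :+ ω :* (θ :* e :- #1)) refl θ ω (proj₁ inverted))
          (trans (+-congʳ (proj₂ (proj₂ (proj₂ inverted)))) (-‿inverseʳ 1#))
        θ≉0 : ¬ θ ≈ 0#
        θ≉0 θ≈0 = θ∉ℚ 0ℚ (trans θ≈0 (sym ι-0))
        θ∈Λ : θ ∈ Λ
        θ∈Λ = 1# , 0# , integer (+ 1) , integer (+ 0) , solve 2 (λ θ ω → θ := #1 :* θ :+ #0 :* ω) refl θ ω
        θz∈Λ : θ * z ∈ Λ
        θz∈Λ = 0# , 1# , integer (+ 0) , integer (+ 1) , trans θz≈ω (solve 2 (λ θ ω → ω := #0 :* θ :+ #1 :* ω) refl θ ω)
        z∉ℚ : Irrational z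
        z∉ℚ r z≈r = Pos⇒≉0 (Pos-suc 2) (proj₂ (proj₂ (independent₃ θ∈K θ∉ℚ
          (integral⇒rational (integer (+ 2) ⊠ p∈ℤ)) (neg-ℚ (rational r)) (integral⇒rational (integer (+ 3)))
          (trans (solve 3 (λ θ p r → con (+ 2) :* p :+ (:- r) :* θ :+ con (+ 3) :* (θ :* θ)
                    := (con (+ 3) :* (θ :* θ) :+ con (+ 2) :* p) :- θ :* r) refl θ p (ι r))
                 (trans (+-congʳ (trans (sym θz≈ω) (*-congˡ z≈r))) (-‿inverseʳ (θ * ι r)))))))
        widen : ∀ y → Pos (fromℤ (+ n) + y) → Pos (fromℤ (+ (2 ℕ.+ n)) + y)
        widen y h = Pos-resp (trans (solve 2 (λ n y → n :+ y :+ con (+ 2) := con (+ 2) :+ n :+ y) refl (fromℤ (+ n)) y)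
                                    (+-congʳ (sym (fromℤ-+ (+ 2) (+ n)))))
                             (Pos-+-ℕ 2 h)

      small-positive-element : Σ[ α ∈ Carrier ] α ∈ Λ × Irrational α × Pos α × Pos (1# + - α)
      small-positive-element = orient small-element
        where
        shrink : ∀ y → Pos (fromℤ (+ 2) + - (y * fromℤ (+ 3))) → Pos (1# + - y)
        shrink y h = Pos-third (Pos-resp (solve 1 (λ y → con (+ 2) :- y :* con (+ 3) :+ #1 := (#1 :- y) :+ (#1 :- y) :+ (#1 :- y)) refl y)
          (Pos-+-ℕ 1 h))
        orient : Σ[ x ∈ Carrier ] x ∈ Λ × ¬ x ≈ 0# × ∣ x * fromℤ (+ 3) ∣< fromℤ (+ 2) → _
        -- A nonzero lattice element is irrational, hence has an inverse in K, and that decides its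
        -- sign.
        orient (x , x∈Λ , x≉0 , x<2 , -2<x) = sign (apart (proj₂ (proj₂ (proj₂ (inverse (Λ⊆K x∈Λ) x∉ℚ)))))
          where
          x∉ℚ : Irrational x
          x∉ℚ = Λ-irrational x∈Λ x≉0
          sign : Pos x ⊎ Pos (- x) → Σ[ α ∈ Carrier ] α ∈ Λ × Irrational α × Pos α × Pos (1# + - α)
          sign (inj₁ x>0) = x , x∈Λ , x∉ℚ , x>0 , shrink x x<2
          sign (inj₂ x<0) = - x , Λ-neg x∈Λ
            , Λ-irrational (Λ-neg x∈Λ) (Pos⇒≉0 x<0)
            , x<0
            , shrink (- x) (Pos-resp (solve 1 (λ x → con (+ 2) :+ x :* con (+ 3) := con (+ 2) :- (:- x :* con (+ 3))) refl x) -2<x)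

      Pos-ℤ : ∀ {x k} → + 0 ℤ.≤ k → Pos x → Pos (x + fromℤ k)
      Pos-ℤ {k = + n} _ = Pos-+-ℕ n

      -- Minus the discriminant of the cofactor X² + θX + θ² + p of X - θ. With f = X³ + pX + q, the
      -- number 4p³ + 27q² equals E f′(θ)².
      E : Carrier
      E = fromℤ (+ 4) * p + fromℤ (+ 3) * θ * θ
      E-square-multiple : Pos (E * ((p + fromℤ (+ 3) * θ * θ) * (p + fromℤ (+ 3) * θ * θ)))
      E-square-multiple = Pos-resp (modulo (fromℤ (+ 27) * (q + - (θ * θ * θ) + - (p * θ)))
        (solve 3 (λ θ p q → con (+ 4) :* p :* p :* p :+ con (+ 27) :* q :* q :=
           (con (+ 4) :* p :+ con (+ 3) :* θ :* θ) :* ((p :+ con (+ 3) :* θ :* θ) :* (p :+ con (+ 3) :* θ :* θ))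
             :+ con (+ 27) :* (q :- θ :* θ :* θ :- p :* θ) :* (θ :* θ :* θ :+ p :* θ :+ q)) refl θ p q)
        cubic) D>0

      -- The quadratic cofactor of X - α has discriminant -(4n + 3α²).
      trace-zero-cubic : ∀ {α} → α ∈ Λ → Σ[ n ∈ ℤ ] Σ[ d ∈ ℤ ] Σ[ w ∈ Carrier ]
        α * α * α + fromℤ n * α + fromℤ d ≈ 0# × fromℤ (+ 4) * fromℤ n + fromℤ (+ 3) * (α * α) ≈ E * (w * w)
      trace-zero-cubic {α} (u , v , u∈ℤ , v∈ℤ , α≈) = package N∈ℤ D∈ℤ
        where
        N D : Carrier
        -- In the conjugates αᵢ of α, N = α₁α₂ + α₁α₃ + α₂α₃ and D = -α₁α₂α₃.
        N = p * u * u + fromℤ (+ 9) * q * u * v + - (fromℤ (+ 3) * p * p * v * v)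
        D = q * u * u * u + - (fromℤ (+ 2) * p * p * p * v * v * v) + - (fromℤ (+ 2) * p * p * u * u * v)
              + - (fromℤ (+ 9) * p * q * u * v * v) + - (fromℤ (+ 27) * q * q * v * v * v)
        N∈ℤ : Integral N
        N∈ℤ = p∈ℤ ⊠ u∈ℤ ⊠ u∈ℤ ⊞ integer (+ 9) ⊠ q∈ℤ ⊠ u∈ℤ ⊠ v∈ℤ ⊟ integer (+ 3) ⊠ p∈ℤ ⊠ p∈ℤ ⊠ v∈ℤ ⊠ v∈ℤ
        D∈ℤ : Integral D
        D∈ℤ = q∈ℤ ⊠ u∈ℤ ⊠ u∈ℤ ⊠ u∈ℤ ⊟ integer (+ 2) ⊠ p∈ℤ ⊠ p∈ℤ ⊠ p∈ℤ ⊠ v∈ℤ ⊠ v∈ℤ ⊠ v∈ℤ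
                ⊟ integer (+ 2) ⊠ p∈ℤ ⊠ p∈ℤ ⊠ u∈ℤ ⊠ u∈ℤ ⊠ v∈ℤ
                ⊟ integer (+ 9) ⊠ p∈ℤ ⊠ q∈ℤ ⊠ u∈ℤ ⊠ v∈ℤ ⊠ v∈ℤ ⊟ integer (+ 27) ⊠ q∈ℤ ⊠ q∈ℤ ⊠ v∈ℤ ⊠ v∈ℤ ⊠ v∈ℤ
        root : α * α * α + N * α + D ≈ 0#
        root = trans (+-congʳ (+-cong (*-cong (*-cong α≈ α≈) α≈) (*-congˡ α≈)))
          (modulo (fromℤ (+ 27) * θ * θ * θ * v * v * v + fromℤ (+ 27) * θ * θ * u * v * v + fromℤ (+ 27) * θ * p * v * v * v
                     + fromℤ (+ 9) * θ * u * u * v + fromℤ (+ 9) * p * u * v * v + - (fromℤ (+ 27) * q * v * v * v) + u * u * u)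
            (solve 5 (λ θ p q u v →
               let ω = con (+ 3) :* (θ :* θ) :+ con (+ 2) :* p
                   α = u :* θ :+ v :* ω
                   N = p :* u :* u :+ con (+ 9) :* q :* u :* v :- con (+ 3) :* p :* p :* v :* v
                   D = q :* u :* u :* u :- con (+ 2) :* p :* p :* p :* v :* v :* v :- con (+ 2) :* p :* p :* u :* u :* v
                         :- con (+ 9) :* p :* q :* u :* v :* v :- con (+ 27) :* q :* q :* v :* v :* v
               in α :* α :* α :+ N :* α :+ D :=
                  #0 :+ (con (+ 27) :* θ :* θ :* θ :* v :* v :* v :+ con (+ 27) :* θ :* θ :* u :* v :* v :+ con (+ 27) :* θ :* p :* v :* v :* v
                          :+ con (+ 9) :* θ :* u :* u :* v :+ con (+ 9) :* p :* u :* v :* v :- con (+ 27) :* q :* v :* v :* v :+ u :* u :* u)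
                        :* (θ :* θ :* θ :+ p :* θ :+ q))
               refl θ p q u v)
            cubic)
        -- For the other two roots θ′, θ″ of the cubic, whose sum is -θ, the conjugates satisfy α′ -
        -- α″ = (θ′ - θ″)(u - 3θv). Squaring gives -(4N + 3α²) on the left and -E times the square
        -- of u - 3θv on the right.
        4N+3α² : fromℤ (+ 4) * N + fromℤ (+ 3) * (α * α) ≈ E * ((u + - (fromℤ (+ 3) * θ * v)) * (u + - (fromℤ (+ 3) * θ * v)))
        4N+3α² = trans (+-congˡ (*-congˡ (*-cong α≈ α≈))) (modulo (fromℤ (+ 36) * u * v)
          (solve 5 (λ θ p q u v →
             let ω = con (+ 3) :* (θ :* θ) :+ con (+ 2) :* p
                 α = u :* θ :+ v :* ω
                 N = p :* u :* u :+ con (+ 9) :* q :* u :* v :- con (+ 3) :* p :* p :* v :* v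
                 w = u :- con (+ 3) :* θ :* v
             in con (+ 4) :* N :+ con (+ 3) :* (α :* α) := (con (+ 4) :* p :+ con (+ 3) :* θ :* θ) :* (w :* w)
                  :+ con (+ 36) :* u :* v :* (θ :* θ :* θ :+ p :* θ :+ q))
             refl θ p q u v)
          cubic)
        package : Integral N → Integral D → _
        package (n , N≈n) (d , D≈d) = n , d , u + - (fromℤ (+ 3) * θ * v)
          , trans (+-cong (+-congˡ (*-congʳ (sym N≈n))) (sym D≈d)) root
          , trans (+-congʳ (*-congˡ (sym N≈n))) 4N+3α²

      coefficient-bounds : ∀ {α n d w} → Pos α → Pos (1# + - α) → α * α * α + fromℤ n * α + fromℤ d ≈ 0# →
        fromℤ (+ 4) * fromℤ n + fromℤ (+ 3) * (α * α) ≈ E * (w * w) → ℤ.- n ℤ.≤ d × d ℤ.≤ ℤ.- (+ 1)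
      coefficient-bounds {α} {n} {d} {w} α>0 α<1 root 4n+3α² = -n≤d , d≤-1
        where
        1-α²>0 : Pos (1# + - (α * α))
        1-α²>0 = Pos-resp (solve 1 (λ α → (#1 :- α) :+ (#1 :- α) :* α := #1 :- α :* α) refl α) (Pos-+ α<1 (Pos-* α<1 α>0))
        n≥0 : + 0 ℤ.≤ n
        -- For n ≤ -1 and α² < 1 the number 4n + 3α² = E w² would be negative, while 4p³ + 27q² is a
        -- positive square multiple of E.
        n≥0 = ℤ.≮⇒≥ λ n<0 → square-multiples-agree _ w E-square-multiple
          (Pos-resp (trans (trans (+-congˡ (trans (fromℤ-* (+ 4) _) (*-congˡ (trans (fromℤ-+ _ _) (+-congʳ (fromℤ-neg n))))))
              (solve 2 (λ n a → con (+ 3) :* (#1 :- a) :+ #1 :+ con (+ 4) :* (:- n :+ con -[1+ 0 ]) := :- (con (+ 4) :* n :+ con (+ 3) :* a)) refl (fromℤ n) (α * α)))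
              (-‿cong 4n+3α²))
            (Pos-ℤ {k = + 4 ℤ.* (ℤ.- n ℤ.+ -[1+ 0 ])} (ℤ.*-monoˡ-≤-nonNeg (+ 4) (negative n<0))
              (Pos-+ (Pos-* (Pos-suc 2) 1-α²>0) Pos-1)))
          where
          negative : ∀ {n} → n ℤ.< + 0 → + 0 ℤ.≤ ℤ.- n ℤ.+ -[1+ 0 ]
          negative {+ n} (ℤ.+<+ ())
          negative { -[1+ n ]} _ = ℤ.+≤+ ℕ.z≤n
        d≤-1 : d ℤ.≤ ℤ.- (+ 1)
        d≤-1 = ℤ.≮⇒≥ λ -1<d → Pos⇒≉0 (Pos-ℤ (nonnegative -1<d) value>0) root
          where
          nonnegative : ∀ {d} → -[1+ 0 ] ℤ.< d → + 0 ℤ.≤ d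
          nonnegative {+ d} _ = ℤ.+≤+ ℕ.z≤n
          nonnegative { -[1+ d ]} (ℤ.-<- ())
          value>0 : Pos (α * α * α + fromℤ n * α)
          value>0 = Pos-resp (solve 2 (λ α n → (α :* α :+ n) :* α := α :* α :* α :+ n :* α) refl α (fromℤ n))
            (Pos-* (Pos-ℤ n≥0 (Pos-* α>0 α>0)) α>0)
        -n≤d : ℤ.- n ℤ.≤ d
        -- If d < -n, the value 1 + n + d of the cubic at 1 is at most 0, and the value at α is
        -- smaller by (1 - α)(α² + α + 1 + n) > 0.
        -n≤d = ℤ.≮⇒≥ λ d<-n → -Pos⇒≉0 (Pos-resp (trans (+-congˡ (slack d))
            (solve 3 (λ α n d → (#1 :- α) :* (α :* α :+ n :+ α :+ #1) :+ (:- n :- #1 :- d) := :- (α :* α :* α :+ n :* α :+ d)) refl α (fromℤ n) (fromℤ d)))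
          (Pos-ℤ (gap d<-n) (Pos-* α<1 (Pos-+ (Pos-+ (Pos-ℤ n≥0 (Pos-* α>0 α>0)) α>0) Pos-1)))) root
          where
          slack : ∀ d → fromℤ (ℤ.- n ℤ.- + 1 ℤ.- d) ≈ - fromℤ n + - 1# + - fromℤ d
          slack d = trans (fromℤ-+ _ (ℤ.- d)) (+-cong (trans (fromℤ-+ (ℤ.- n) _) (+-cong (fromℤ-neg n) (fromℤ-neg (+ 1)))) (fromℤ-neg d))
          gap : ∀ {d} → d ℤ.< ℤ.- n → + 0 ℤ.≤ ℤ.- n ℤ.- + 1 ℤ.- d
          gap d<-n = ℤ.i≤j⇒0≤j-i (subst (_ ℤ.≤_) (ℤ.+-comm (ℤ.- (+ 1)) (ℤ.- n)) (ℤ.i<j⇒i≤pred[j] d<-n))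

      small-root : Σ[ α ∈ Carrier ] α ∈ K × Irrational α × Pos α × Pos (1# + - α) ×
        Σ[ n ∈ ℤ ] Σ[ d ∈ ℤ ] ℤ.- n ℤ.≤ d × d ℤ.≤ ℤ.- (+ 1) × α * α * α + fromℤ n * α + fromℤ d ≈ 0#
      small-root =
        let α , α∈Λ , α∉ℚ , α>0 , α<1 = small-positive-element
            n , d , w , root , 4n+3α² = trace-zero-cubic α∈Λ
            -n≤d , d≤-1 = coefficient-bounds {α} {n} {d} {w} α>0 α<1 root 4n+3α²
        in α , Λ⊆K α∈Λ , α∉ℚ , α>0 , α<1 , n , d , -n≤d , d≤-1 , root

    small-root : (∀ {θ p q} → θ ∈ K → Irrational θ → Integral p → Integral q → θ * θ * θ + p * θ + q ≈ 0# →
        Pos (fromℤ (+ 4) * p * p * p + fromℤ (+ 27) * q * q)) →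
      Σ[ α ∈ Carrier ] α ∈ K × Irrational α × Pos α × Pos (1# + - α) ×
      Σ[ n ∈ ℤ ] Σ[ d ∈ ℤ ] ℤ.- n ℤ.≤ d × d ℤ.≤ ℤ.- (+ 1) × α * α * α + fromℤ n * α + fromℤ d ≈ 0#
    small-root D>0 =
      let θ , θ∈K , θ∉ℚ , p , q , p∈ℤ , q∈ℤ , cubic = depressed-cubic
      in SmallRoot.small-root θ∈K θ∉ℚ p∈ℤ q∈ℤ cubic (D>0 θ∈K θ∉ℚ p∈ℤ q∈ℤ cubic)

open import Defs

-- Cauchy sequences as an instance of the abstract real line.

module RealSequences where

  open ≡ using (refl; sym; trans)
  open Cauchy using (0<½ε; ½+½; bounded; divide; *-estimate)

  ∣p∣<ε⇒p<ε : ∀ p {ε} → ∣ p ∣ ℚ.< ε → p ℚ.< ε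
  ∣p∣<ε⇒p<ε p h with ℚ.≤-total 0ℚ p
  ... | inj₁ 0≤p = subst (ℚ._< _) (ℚ.0≤p⇒∣p∣≡p 0≤p) h
  ... | inj₂ p≤0 = ℚ.≤-<-trans (ℚ.≤-trans p≤0 (ℚ.0≤∣p∣ p)) h

  p<ε∧-p<ε⇒∣p∣<ε : ∀ p {ε} → p ℚ.< ε → ℚ.- p ℚ.< ε → ∣ p ∣ ℚ.< ε
  p<ε∧-p<ε⇒∣p∣<ε p h k with ℚ.∣p∣≡p∨∣p∣≡-p p
  ... | inj₁ eq = subst (ℚ._< _) (sym eq) h
  ... | inj₂ eq = subst (ℚ._< _) (sym eq) k

  pointwise : ∀ {x y} → (∀ n → seq x n ≡ seq y n) → x ≈ y
  pointwise {x} {y} h ε ε>0 = 0 , λ n _ →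
    subst (λ p → ∣ p ∣ ℚ.< ε)
      (sym (trans (cong (ℚ._- seq y n) (h n)) (ℚ.+-inverseʳ (seq y n)))) ε>0

  ≈-refl : ∀ {x} → x ≈ x
  ≈-refl {x} = pointwise {x} {x} (λ _ → refl)

  ≈-sym : ∀ {x y} → x ≈ y → y ≈ x
  ≈-sym {x} {y} h ε ε>0 with h ε ε>0
  ... | N , k = N , λ n n≥ → subst (ℚ._< ε) (flip (seq x n) (seq y n)) (k n n≥)
    where
    flip : ∀ a b → ∣ a ℚ.- b ∣ ≡ ∣ b ℚ.- a ∣
    flip a b = trans (sym (ℚ.∣-p∣≡∣p∣ (a ℚ.- b))) (cong ∣_∣ (solve 2 (λ a b → :- (a :- b) := b :- a) refl a b))
      where open +-*-Solver

  ∣sum∣<ε : ∀ p q ε → ∣ p ∣ ℚ.< ½ ℚ.* ε → ∣ q ∣ ℚ.< ½ ℚ.* ε → ∣ p ℚ.+ q ∣ ℚ.< ε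
  ∣sum∣<ε p q ε hp hq = begin-strict
    ∣ p ℚ.+ q ∣               ≤⟨ ℚ.∣p+q∣≤∣p∣+∣q∣ p q ⟩
    ∣ p ∣ ℚ.+ ∣ q ∣           <⟨ ℚ.+-mono-< hp hq ⟩
    ½ ℚ.* ε ℚ.+ ½ ℚ.* ε       ≡⟨ ½+½ ε ⟩
    ε                         ∎
    where open ℚ.≤-Reasoning

  ≈-trans : ∀ {x y z} → x ≈ y → y ≈ z → x ≈ z
  ≈-trans {x} {y} {z} h k ε ε>0 with h (½ ℚ.* ε) (0<½ε ε ε>0) | k (½ ℚ.* ε) (0<½ε ε ε>0)
  ... | M , h′ | N , k′ = M ℕ.⊔ N , λ n n≥ →
    subst (λ p → ∣ p ∣ ℚ.< ε) (telescope (seq x n) (seq y n) (seq z n))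
      (∣sum∣<ε (seq x n ℚ.- seq y n) (seq y n ℚ.- seq z n) ε
        (h′ n (ℕ.m⊔n≤o⇒m≤o M N n≥)) (k′ n (ℕ.m⊔n≤o⇒n≤o M N n≥)))
    where
    open +-*-Solver
    telescope : ∀ a b c → (a ℚ.- b) ℚ.+ (b ℚ.- c) ≡ a ℚ.- c
    telescope = solve 3 (λ a b c → (a :- b) :+ (b :- c) := a :- c) refl

  +-cong : ∀ {x y u v} → x ≈ y → u ≈ v → x + u ≈ y + v
  +-cong {x} {y} {u} {v} h k ε ε>0 with h (½ ℚ.* ε) (0<½ε ε ε>0) | k (½ ℚ.* ε) (0<½ε ε ε>0)
  ... | M , h′ | N , k′ = M ℕ.⊔ N , λ n n≥ →
    subst (λ p → ∣ p ∣ ℚ.< ε) (rearrange (seq x n) (seq y n) (seq u n) (seq v n))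
      (∣sum∣<ε (seq x n ℚ.- seq y n) (seq u n ℚ.- seq v n) ε
        (h′ n (ℕ.m⊔n≤o⇒m≤o M N n≥)) (k′ n (ℕ.m⊔n≤o⇒n≤o M N n≥)))
    where
    open +-*-Solver
    rearrange : ∀ a b c d → (a ℚ.- b) ℚ.+ (c ℚ.- d) ≡ (a ℚ.+ c) ℚ.- (b ℚ.+ d)
    rearrange = solve 4 (λ a b c d → (a :- b) :+ (c :- d) := (a :+ c) :- (b :+ d)) refl

  neg-cong : ∀ {x y} → x ≈ y → - x ≈ - y
  neg-cong {x} {y} h ε ε>0 with h ε ε>0
  ... | N , k = N , λ n n≥ → subst (ℚ._< ε) (flip (seq x n) (seq y n)) (k n n≥)
    where
    flip : ∀ a b → ∣ a ℚ.- b ∣ ≡ ∣ ℚ.- a ℚ.- ℚ.- b ∣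
    flip a b = trans (sym (ℚ.∣-p∣≡∣p∣ (a ℚ.- b))) (cong ∣_∣ (ℚ.neg-distrib-+ a (ℚ.- b)))

  *-cong : ∀ {x y u v} → x ≈ y → u ≈ v → x * u ≈ y * v
  *-cong {x} {y} {u} {v} h k ε ε>0 =
    let A , A>0 , M , x≤A = bounded (cauchy x)
        B , B>0 , N , v≤B = bounded (cauchy v)
        δ , δ>0 , Bδ≡ = divide B (½ ℚ.* ε) B>0 (0<½ε ε ε>0)
        η , η>0 , Aη≡ = divide A (½ ℚ.* ε) A>0 (0<½ε ε ε>0)
        M′ , h′ = h δ δ>0
        N′ , k′ = k η η>0
        P = M ℕ.⊔ N
        Q = M′ ℕ.⊔ N′
    in P ℕ.⊔ Q , λ n n≥ →
      let P≤n = ℕ.m⊔n≤o⇒m≤o P Q n≥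
          Q≤n = ℕ.m⊔n≤o⇒n≤o P Q n≥
      in *-estimate ε (seq x n) (seq u n) (seq y n) (seq v n) A>0 B>0 Aη≡ Bδ≡
           (x≤A n (ℕ.m⊔n≤o⇒m≤o M N P≤n)) (v≤B n (ℕ.m⊔n≤o⇒n≤o M N P≤n))
           (h′ n (ℕ.m⊔n≤o⇒m≤o M′ N′ Q≤n)) (k′ n (ℕ.m⊔n≤o⇒n≤o M′ N′ Q≤n))

  ℝ-commutativeRing : CommutativeRing 0ℓ 0ℓ
  ℝ-commutativeRing = record
    { Carrier = ℝ ; _≈_ = _≈_ ; _+_ = _+_ ; _*_ = _*_ ; -_ = -_ ; 0# = 0ℝ ; 1# = 1ℝ
    ; isCommutativeRing = record
      { isRing = record
        { +-isAbelianGroup = record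
          { isGroup = record
            { isMonoid = record
              { isSemigroup = record
                { isMagma = record
                  { isEquivalence = record
                    { refl = λ {x} → ≈-refl {x}
                    ; sym = λ {x y} → ≈-sym {x} {y}
                    ; trans = λ {x y z} → ≈-trans {x} {y} {z}
                    }
                  ; ∙-cong = λ {x y u v} → +-cong {x} {y} {u} {v}
                  }
                ; assoc = λ x y z → pointwise {(x + y) + z} {x + (y + z)} (λ n → ℚ.+-assoc (seq x n) (seq y n) (seq z n))
                }
              ; identity = (λ x → pointwise {0ℝ + x} {x} (λ n → ℚ.+-identityˡ (seq x n)))
                         , (λ x → pointwise {x + 0ℝ} {x} (λ n → ℚ.+-identityʳ (seq x n)))
              }
            ; inverse = (λ x → pointwise { - x + x} {0ℝ} (λ n → ℚ.+-inverseˡ (seq x n)))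
                      , (λ x → pointwise {x + - x} {0ℝ} (λ n → ℚ.+-inverseʳ (seq x n)))
            ; ⁻¹-cong = λ {x y} → neg-cong {x} {y}
            }
          ; comm = λ x y → pointwise {x + y} {y + x} (λ n → ℚ.+-comm (seq x n) (seq y n))
          }
        ; *-cong = λ {x y u v} → *-cong {x} {y} {u} {v}
        ; *-assoc = λ x y z → pointwise {(x * y) * z} {x * (y * z)} (λ n → ℚ.*-assoc (seq x n) (seq y n) (seq z n))
        ; *-identity = (λ x → pointwise {1ℝ * x} {x} (λ n → ℚ.*-identityˡ (seq x n)))
                     , (λ x → pointwise {x * 1ℝ} {x} (λ n → ℚ.*-identityʳ (seq x n)))
        ; distrib = (λ x y z → pointwise {x * (y + z)} {x * y + x * z} (λ n → ℚ.*-distribˡ-+ (seq x n) (seq y n) (seq z n)))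
                  , (λ x y z → pointwise {(y + z) * x} {y * x + z * x} (λ n → ℚ.*-distribʳ-+ (seq x n) (seq y n) (seq z n)))
        }
      ; *-comm = λ x y → pointwise {x * y} {y * x} (λ n → ℚ.*-comm (seq x n) (seq y n))
      }
    }

  abstract

    0<-resp-≈ : ∀ {x y} → x ≈ y → 0ℝ < x → 0ℝ < y
    0<-resp-≈ {x} {y} x≈y (ε , ε>0 , M , h) with x≈y (½ ℚ.* ε) (0<½ε ε ε>0)
    ... | N , k = ½ ℚ.* ε , 0<½ε ε ε>0 , M ℕ.⊔ N , λ n n≥ →
      bound (seq x n) (seq y n) (h n (ℕ.m⊔n≤o⇒m≤o M N n≥)) (k n (ℕ.m⊔n≤o⇒n≤o M N n≥))
      where
      open ℚ.≤-Reasoning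
      bound : ∀ a b → 0ℚ ℚ.+ ε ℚ.≤ a → ∣ a ℚ.- b ∣ ℚ.< ½ ℚ.* ε → 0ℚ ℚ.+ ½ ℚ.* ε ℚ.≤ b
      bound a b ε≤a close = begin
        0ℚ ℚ.+ ½ ℚ.* ε                 ≡⟨ solve 1 (λ e → con 0ℚ :+ con ½ :* e := (con 0ℚ :+ e) :- con ½ :* e) refl ε ⟩
        (0ℚ ℚ.+ ε) ℚ.- ½ ℚ.* ε         ≤⟨ ℚ.+-mono-≤ ε≤a (ℚ.neg-antimono-≤ (ℚ.<⇒≤ (∣p∣<ε⇒p<ε (a ℚ.- b) close))) ⟩
        a ℚ.- (a ℚ.- b)                ≡⟨ solve 2 (λ a b → a :- (a :- b) := b) refl a b ⟩
        b                              ∎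
        where open +-*-Solver

    0<-+ : ∀ {x y} → 0ℝ < x → 0ℝ < y → 0ℝ < x + y
    0<-+ {x} {y} (ε , ε>0 , M , h) (δ , δ>0 , N , k) =
      ε ℚ.+ δ , ℚ.+-mono-< ε>0 δ>0 , M ℕ.⊔ N , λ n n≥ →
      subst (ℚ._≤ seq x n ℚ.+ seq y n)
        (solve 2 (λ a b → (con 0ℚ :+ a) :+ (con 0ℚ :+ b) := con 0ℚ :+ (a :+ b)) refl ε δ)
        (ℚ.+-mono-≤ (h n (ℕ.m⊔n≤o⇒m≤o M N n≥)) (k n (ℕ.m⊔n≤o⇒n≤o M N n≥)))
      where open +-*-Solver

    0<-* : ∀ {x y} → 0ℝ < x → 0ℝ < y → 0ℝ < x * y
    0<-* {x} {y} (ε , ε>0 , M , h) (δ , δ>0 , N , k) =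
      ε ℚ.* δ , ℚ.positive⁻¹ (ε ℚ.* δ) {{ℚ.pos*pos⇒pos ε {{ℚ.positive ε>0}} δ {{ℚ.positive δ>0}}}}
      , M ℕ.⊔ N , λ n n≥ →
      bound (seq x n) (seq y n) (h n (ℕ.m⊔n≤o⇒m≤o M N n≥)) (k n (ℕ.m⊔n≤o⇒n≤o M N n≥))
      where
      open ℚ.≤-Reasoning
      bound : ∀ a b → 0ℚ ℚ.+ ε ℚ.≤ a → 0ℚ ℚ.+ δ ℚ.≤ b → 0ℚ ℚ.+ ε ℚ.* δ ℚ.≤ a ℚ.* b
      bound a b ε≤a δ≤b = begin
        0ℚ ℚ.+ ε ℚ.* δ        ≡⟨ ℚ.+-identityˡ (ε ℚ.* δ) ⟩
        ε ℚ.* δ               ≤⟨ ℚ.*-monoʳ-≤-nonNeg δ {{ℚ.nonNegative (ℚ.<⇒≤ δ>0)}} (subst (ℚ._≤ a) (ℚ.+-identityˡ ε) ε≤a) ⟩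
        a ℚ.* δ               ≤⟨ ℚ.*-monoˡ-≤-nonNeg a {{ℚ.nonNegative 0≤a}} (subst (ℚ._≤ b) (ℚ.+-identityˡ δ) δ≤b) ⟩
        a ℚ.* b               ∎
        where
        0≤a : 0ℚ ℚ.≤ a
        0≤a = ℚ.≤-trans (ℚ.<⇒≤ ε>0) (subst (ℚ._≤ a) (ℚ.+-identityˡ ε) ε≤a)

    0<-fromℚ : ∀ {q} → 0ℚ ℚ.< q → 0ℝ < fromℚ q
    0<-fromℚ {q} q>0 = q , q>0 , 0 , λ _ _ → ℚ.≤-reflexive (ℚ.+-identityˡ q)

    0<-fromℚ⁻¹ : ∀ {q} → 0ℝ < fromℚ q → 0ℚ ℚ.< q
    0<-fromℚ⁻¹ {q} (ε , ε>0 , N , h) =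
      ℚ.<-≤-trans ε>0 (subst (ℚ._≤ q) (ℚ.+-identityˡ ε) (h N ℕ.≤-refl))

    -- With x + y ≥ ε eventually, fix N beyond which x varies by less than ε/4 and compare the
    -- rational x_N with ε/2. If it is at least ε/2, then x ≥ ε/4 eventually; otherwise y ≥ ε - ε/2
    -- - ε/4 eventually.
    0<-cotrans : ∀ x y → 0ℝ < x + y → 0ℝ < x ⊎ 0ℝ < y
    0<-cotrans x y (ε , ε>0 , M , h) = decide (cauchy x ε/4 ε/4>0)
      where
      open +-*-Solver
      open ℚ.≤-Reasoning
      ε/4 : ℚ
      ε/4 = ½ ℚ.* (½ ℚ.* ε)
      ε/4>0 : 0ℚ ℚ.< ε/4
      ε/4>0 = 0<½ε (½ ℚ.* ε) (0<½ε ε ε>0)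

      decide : Σ[ N ∈ ℕ ] (∀ i j → N ℕ.≤ i → N ℕ.≤ j → ∣ seq x i ℚ.- seq x j ∣ ℚ.< ε/4) → 0ℝ < x ⊎ 0ℝ < y
      decide (N , close) with ½ ℚ.* ε ℚ.≤? seq x N
      ... | yes large = inj₁ (ε/4 , ε/4>0 , N , λ n n≥ → begin
        0ℚ ℚ.+ ε/4                             ≡⟨ solve 1 (λ e → con 0ℚ :+ con ½ :* (con ½ :* e) := con ½ :* e :- con ½ :* (con ½ :* e)) refl ε ⟩
        ½ ℚ.* ε ℚ.- ε/4                        ≤⟨ ℚ.+-mono-≤ large (ℚ.neg-antimono-≤ (ℚ.<⇒≤ (∣p∣<ε⇒p<ε (seq x N ℚ.- seq x n) (close N n ℕ.≤-refl n≥)))) ⟩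
        seq x N ℚ.- (seq x N ℚ.- seq x n)      ≡⟨ solve 2 (λ a b → a :- (a :- b) := b) refl (seq x N) (seq x n) ⟩
        seq x n                                ∎)
      ... | no small = inj₂ (ε/4 , ε/4>0 , M ℕ.⊔ N , λ n n≥ → begin
        0ℚ ℚ.+ ε/4
          ≡⟨ solve 1 (λ e → con 0ℚ :+ con ½ :* (con ½ :* e) := ((con 0ℚ :+ e) :- con ½ :* e) :- con ½ :* (con ½ :* e)) refl ε ⟩
        ((0ℚ ℚ.+ ε) ℚ.- ½ ℚ.* ε) ℚ.- ε/4
          ≤⟨ ℚ.+-mono-≤ (ℚ.+-mono-≤ (h n (ℕ.m⊔n≤o⇒m≤o M N n≥)) (ℚ.neg-antimono-≤ (ℚ.<⇒≤ (ℚ.≰⇒> small))))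
               (ℚ.neg-antimono-≤ (ℚ.<⇒≤ (∣p∣<ε⇒p<ε (seq x n ℚ.- seq x N) (close n N (ℕ.m⊔n≤o⇒n≤o M N n≥) ℕ.≤-refl)))) ⟩
        ((seq x n ℚ.+ seq y n) ℚ.- seq x N) ℚ.- (seq x n ℚ.- seq x N)
          ≡⟨ solve 3 (λ a b c → ((a :+ b) :- c) :- (a :- c) := b) refl (seq x n) (seq y n) (seq x N) ⟩
        seq y n ∎)

    archimedean : ∀ x → Σ[ q ∈ ℚ ] 0ℝ < fromℚ q + - x
    archimedean x =
      let B , _ , N , h = bounded (cauchy x)
      in 1ℚ ℚ.+ B , 1ℚ , ℚ.positive⁻¹ 1ℚ , N , λ n n≥ →
           subst₂ ℚ._≤_ (solve 1 (λ b → con 1ℚ :+ b :- b := con 0ℚ :+ con 1ℚ) refl B) refl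
             (ℚ.+-monoʳ-≤ (1ℚ ℚ.+ B) (ℚ.neg-antimono-≤ (ℚ.≤-trans (p≤∣p∣ (seq x n)) (h n n≥))))
      where
      open +-*-Solver
      p≤∣p∣ : ∀ p → p ℚ.≤ ∣ p ∣
      p≤∣p∣ p with ℚ.≤-total 0ℚ p
      ... | inj₁ 0≤p = ℚ.≤-reflexive (sym (ℚ.0≤p⇒∣p∣≡p 0≤p))
      ... | inj₂ p≤0 = ℚ.≤-trans p≤0 (ℚ.0≤∣p∣ p)

    infinitesimal⇒≈0 : ∀ x → (∀ ε → 0ℚ ℚ.< ε → 0ℝ < fromℚ ε + - x × 0ℝ < fromℚ ε + x) → x ≈ 0ℝ
    infinitesimal⇒≈0 x h ε ε>0 with h ε ε>0
    ... | (δ , δ>0 , M , upper) , (η , η>0 , N , lower) = M ℕ.⊔ N , λ n n≥ →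
      subst (λ p → ∣ p ∣ ℚ.< ε) (sym (ℚ.+-identityʳ (seq x n)))
        (p<ε∧-p<ε⇒∣p∣<ε (seq x n)
          (subst (seq x n ℚ.<_) (solve 2 (λ e a → (e :- a) :+ a := e) refl ε (seq x n))
            (strict (seq x n) δ>0 (upper n (ℕ.m⊔n≤o⇒m≤o M N n≥))))
          (subst (ℚ.- seq x n ℚ.<_) (solve 2 (λ e a → (e :+ a) :- a := e) refl ε (seq x n))
            (strict (ℚ.- seq x n) η>0 (lower n (ℕ.m⊔n≤o⇒n≤o M N n≥)))))
      where
      open +-*-Solver
      strict : ∀ a {b δ} → 0ℚ ℚ.< δ → 0ℚ ℚ.+ δ ℚ.≤ b → a ℚ.< b ℚ.+ a
      strict a {b} {δ} δ>0 δ≤b =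
        subst (ℚ._< b ℚ.+ a) (ℚ.+-identityˡ a)
          (ℚ.+-monoˡ-< a (ℚ.<-≤-trans δ>0 (subst (ℚ._≤ b) (ℚ.+-identityˡ δ) δ≤b)))

ℝ-line : RealLine
ℝ-line = record
  { Carrier = ℝ ; _≈_ = _≈_ ; _+_ = _+_ ; _*_ = _*_ ; -_ = -_ ; fromℤ = fromℤ
  ; isCommutativeRing = CommutativeRing.isCommutativeRing ℝ-commutativeRing
  ; fromℤ-+ = λ k l → pointwise {fromℤ (k ℤ.+ l)} {fromℤ k + fromℤ l} (λ _ → /1-+ k l)
  ; fromℤ-* = λ k l → pointwise {fromℤ (k ℤ.* l)} {fromℤ k * fromℤ l} (λ _ → /1-* k l)
  ; fromℤ-neg = λ k → pointwise {fromℤ (ℤ.- k)} { - fromℤ k} (λ _ → /1-neg k)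
  ; ι = fromℚ
  ; ι-/1 = λ k → ≈-refl {fromℤ k}
  ; ι-+ = λ p q → ≈-refl {fromℚ p + fromℚ q}
  ; ι-* = λ p q → ≈-refl {fromℚ p * fromℚ q}
  ; ι-neg = λ p → ≈-refl { - fromℚ p}
  ; Pos = 0ℝ <_
  ; Pos-resp = λ {x y} → 0<-resp-≈ {x} {y}
  ; Pos-+ = λ {x y} → 0<-+ {x} {y}
  ; Pos-* = λ {x y} → 0<-* {x} {y}
  ; Pos-ι = 0<-fromℚ
  ; Pos-ι⁻¹ = 0<-fromℚ⁻¹
  ; cotrans = 0<-cotrans
  ; archimedean = archimedean
  ; infinitesimal⇒≈0 = infinitesimal⇒≈0
  }
  where open RealSequences

module ℝ-theory = RealLineTheory ℝ-line

0<1-x⇒x<1 : ∀ x → 0ℝ < 1ℝ + - x → x < 1ℝ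
0<1-x⇒x<1 x (ε , ε>0 , N , h) = ε , ε>0 , N , λ n n≥ →
  subst₂ ℚ._≤_
    (solve 2 (λ e a → (con 0ℚ :+ e) :+ a := a :+ e) ≡.refl ε (seq x n))
    (solve 1 (λ a → (con 1ℚ :- a) :+ a := con 1ℚ) ≡.refl (seq x n))
    (ℚ.+-monoˡ-≤ (seq x n) (h n n≥))
  where open +-*-Solver

-- The integer inequalities for S₀ and S₋₃.

module Membership where

  open ℤSolver.+-*-Solver

  ≤-from-difference : ∀ {i j k} → j ℤ.- i ≡ k → + 0 ℤ.≤ k → i ℤ.≤ j
  ≤-from-difference eq k≥0 = ℤ.0≤i-j⇒j≤i (subst (+ 0 ℤ.≤_) (≡.sym eq) k≥0)

  module _ {n d : ℤ} (-n≤d : ℤ.- n ℤ.≤ d) (d≤-1 : d ℤ.≤ ℤ.- (+ 1)) where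

    n-1≥0 : + 0 ℤ.≤ n ℤ.- + 1
    n-1≥0 = ℤ.i≤j⇒0≤j-i (ℤ.neg-cancel-≤ (ℤ.≤-trans -n≤d d≤-1))

    1≤n : + 1 ℤ.≤ n
    1≤n = ℤ.0≤i-j⇒j≤i n-1≥0

    3n≥0 : + 0 ℤ.≤ + 3 ℤ.* n
    3n≥0 = ℤ.*-monoˡ-≤-nonNeg (+ 3) (ℤ.≤-trans (ℤ.+≤+ ℕ.z≤n) 1≤n)

    n+d≥0 : + 0 ℤ.≤ d ℤ.- (ℤ.- n)
    n+d≥0 = ℤ.i≤j⇒0≤j-i -n≤d

    -1-d≥0 : + 0 ℤ.≤ ℤ.- (+ 1) ℤ.- d
    -1-d≥0 = ℤ.i≤j⇒0≤j-i d≤-1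

    S₀ : ∀ {α} → 0ℝ < α → α < 1ℝ → α ^ 3 + fromℤ (+ 0) * α ^ 2 + fromℤ n * α + fromℤ d ≈ 0ℝ → α ∈ S (+ 0)
    S₀ α>0 α<1 root = n , 1≤n
      , ≤-from-difference (solve 1 (λ n → con (+ 0) :- (con (+ 0) :- con (+ 3) :* n) := con (+ 3) :* n) ≡.refl n) 3n≥0
      , subst (+ 1 ℤ.≤_) (≡.sym (ℤ.+-identityˡ n)) 1≤n
      , α>0 , α<1 , d
      , subst (ℤ._≤ d) (cong ℤ.-_ (≡.sym (ℤ.+-identityˡ n))) -n≤d , d≤-1 , root

    -- The reflection exchanges the two bounds: -n ≤ -(1 + n + d) amounts to d ≤ -1, and -(1 + n +
    -- d) ≤ -1 to -n ≤ d.
    S₋₃ : ∀ {α} → 0ℝ < α → α < 1ℝ →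
      α ^ 3 + fromℤ (ℤ.- (+ 3)) * α ^ 2 + fromℤ (+ 3 ℤ.+ n) * α + fromℤ (ℤ.- (+ 1 ℤ.+ n ℤ.+ d)) ≈ 0ℝ →
      α ∈ S (ℤ.- (+ 3))
    S₋₃ α>0 α<1 root = + 3 ℤ.+ n
      , ≤-from-difference (solve 1 (λ n → (con (+ 3) :+ n) :- con (+ 4) := n :- con (+ 1)) ≡.refl n) n-1≥0
      , ≤-from-difference (solve 1 (λ n → con (+ 0) :- (con (+ 9) :- con (+ 3) :* (con (+ 3) :+ n)) := con (+ 3) :* n) ≡.refl n) 3n≥0
      , ≤-from-difference (solve 1 (λ n → (con -[1+ 2 ] :+ (con (+ 3) :+ n)) :- con (+ 1) := n :- con (+ 1)) ≡.refl n) n-1≥0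
      , α>0 , α<1 , ℤ.- (+ 1 ℤ.+ n ℤ.+ d)
      , ≤-from-difference (solve 2 (λ n d → :- (con (+ 1) :+ n :+ d) :- (:- (con -[1+ 2 ] :+ (con (+ 3) :+ n))) := con -[1+ 0 ] :- d) ≡.refl n d) -1-d≥0
      , ≤-from-difference (solve 2 (λ n d → con -[1+ 0 ] :- (:- (con (+ 1) :+ n :+ d)) := d :- (:- n)) ≡.refl n d) n+d≥0
      , root

-- Primitive elements of a real cubic field that is not totally real.

module _ {ℓ} (K : RealCubicField ℓ) where

  open RealCubicField K
  open IsBasis (proj₂ degree)
  open ℝ-theory using
    ( Irrational; Integral; Pos-discriminant?; subfield-contains-ℚ
    ; cubic-without-square-term; reflected-cubic; reflected-irrational; reflected-positive )

  ℚ⟨α⟩⊆K : ∀ {α} → α ∈ carrier → ℚ⟨ α ⟩ ⊆ carrier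
  ℚ⟨α⟩⊆K α∈K generator                 = α∈K
  ℚ⟨α⟩⊆K α∈K (resp {x} {y} x≈y x∈)     = resp-≈ {x} {y} x≈y (ℚ⟨α⟩⊆K α∈K x∈)
  ℚ⟨α⟩⊆K α∈K zero                      = 0-closed
  ℚ⟨α⟩⊆K α∈K one                       = 1-closed
  ℚ⟨α⟩⊆K α∈K (plus {x} {y} x∈ y∈)      = +-closed {x} {y} (ℚ⟨α⟩⊆K α∈K x∈) (ℚ⟨α⟩⊆K α∈K y∈)
  ℚ⟨α⟩⊆K α∈K (times {x} {y} x∈ y∈)     = *-closed {x} {y} (ℚ⟨α⟩⊆K α∈K x∈) (ℚ⟨α⟩⊆K α∈K y∈)
  ℚ⟨α⟩⊆K α∈K (negate {x} x∈)           = neg-closed {x} (ℚ⟨α⟩⊆K α∈K x∈)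
  ℚ⟨α⟩⊆K α∈K (invert {x} {y} x∈ xy≈1)  = inverse-closed {x} {y} (ℚ⟨α⟩⊆K α∈K x∈) xy≈1

  fromℚ∈ℚ⟨α⟩ : ∀ {α} q → fromℚ q ∈ ℚ⟨ α ⟩
  fromℚ∈ℚ⟨α⟩ {α} = subfield-contains-ℚ ℚ⟨ α ⟩ (λ {x y} → resp {x = x} {y}) one
    (λ {x y} → plus {x = x} {y}) (λ {x y} → times {x = x} {y}) (λ {x} → negate {x = x}) (λ {x y} → invert {x = x} {y})

  private
    module C = ℝ-theory.CubicField carrier
      (λ {x y} → resp-≈ {x} {y}) (λ {x y} → +-closed {x} {y}) (λ {x y} → *-closed {x} {y}) (λ {x} → neg-closed {x})
      -- Every rational lies in ℚ⟨ 0 ⟩, which is contained in K.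
      (λ q → ℚ⟨α⟩⊆K 0-closed (fromℚ∈ℚ⟨α⟩ q))
      (proj₁ degree) member independent spanning

  irrational⇒primitive : ∀ {α} → α ∈ carrier → Irrational α → α ∈ IsPrimitiveElement K
  irrational⇒primitive {α} α∈K α∉ℚ = (λ {x} → C.generates {α} α∈K α∉ℚ ℚ⟨ α ⟩ (λ {x y} → resp {x = x} {y})
      (λ {x y} → plus {x = x} {y}) (λ {x y} → times {x = x} {y}) fromℚ∈ℚ⟨α⟩ generator {x})
    , ℚ⟨α⟩⊆K α∈K

  -- Were this integer not positive, every embedding would be real. Its positivity is decidable, so
  -- refuting the negation proves it.
  non-real-embedding⇒0<D : ¬ TotallyReal K → ∀ {θ p q} → θ ∈ carrier → Irrational θ → Integral p → Integral q →
    θ * θ * θ + p * θ + q ≈ 0ℝ → 0ℝ < fromℤ (+ 4) * p * p * p + fromℤ (+ 27) * q * q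
  non-real-embedding⇒0<D ¬totally-real {θ} {p} {q} θ∈K θ∉ℚ p∈ℤ q∈ℤ cubic =
    decidable-stable (Pos-discriminant? {p} {q} p∈ℤ q∈ℤ) (λ D≯0 → ¬totally-real (all-real D≯0))
    where
    all-real : ¬ 0ℝ < fromℤ (+ 4) * p * p * p + fromℤ (+ 27) * q * q → TotallyReal K
    all-real D≯0 σ σ-embedding = C.Embedding.real-image (λ x → re (σ x)) (λ x → im (σ x))
        (λ x y x≈y → ⟦⟧-cong {x} {y} x≈y)
        (λ {x y} x∈K y∈K → +-homo (x , x∈K) (y , y∈K))
        (λ {x y} x∈K y∈K → *-homo (x , x∈K) (y , y∈K))
        (λ {x} x∈K → -‿homo (x , x∈K))
        σ-1 {θ} {p} {q} θ∈K θ∉ℚ p∈ℤ q∈ℤ cubic D≯0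
      where
      open RingMorphisms.IsRingMonomorphism σ-embedding
      -- The unit of the abstract theory carries another membership proof than the unit of
      -- `rawRing`; congruence of σ identifies their images.
      σ-1 : re (σ (1ℝ , C.K-1)) ≈ 1ℝ × im (σ (1ℝ , C.K-1)) ≈ 0ℝ
      σ-1 = ≈-trans {re (σ (1ℝ , C.K-1))} {re (σ (1ℝ , 1-closed))} {1ℝ} (proj₁ congruent) (proj₁ 1#-homo)
          , ≈-trans {im (σ (1ℝ , C.K-1))} {im (σ (1ℝ , 1-closed))} {0ℝ} (proj₂ congruent) (proj₂ 1#-homo)
        where
        open RealSequences using (≈-refl; ≈-trans)
        congruent = ⟦⟧-cong {1ℝ , C.K-1} {1ℝ , 1-closed} (≈-refl {1ℝ})

  SmallRoot : Set ℓ
  SmallRoot = Σ[ α ∈ ℝ ] α ∈ carrier × Irrational α × 0ℝ < α × 0ℝ < 1ℝ + - α ×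
    Σ[ n ∈ ℤ ] Σ[ d ∈ ℤ ] ℤ.- n ℤ.≤ d × d ℤ.≤ ℤ.- (+ 1) × α * α * α + fromℤ n * α + fromℤ d ≈ 0ℝ

  small-root : ¬ TotallyReal K → SmallRoot
  small-root ¬totally-real = C.small-root (λ {θ p q} → non-real-embedding⇒0<D ¬totally-real {θ} {p} {q})

  small-root⇒primitive-elements : SmallRoot →
    (Σ[ α ∈ ℝ ] α ∈ S (+ 0) × α ∈ IsPrimitiveElement K) ×
    (Σ[ α ∈ ℝ ] α ∈ S (ℤ.- (+ 3)) × α ∈ IsPrimitiveElement K)
  small-root⇒primitive-elements (α , α∈K , α∉ℚ , α>0 , 1-α>0 , n , d , -n≤d , d≤-1 , root) =
      ( α
      , Membership.S₀ {n} {d} -n≤d d≤-1 {α} α>0 (0<1-x⇒x<1 α 1-α>0) (cubic-without-square-term {α} {n} {d} root)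
      , irrational⇒primitive {α} α∈K α∉ℚ )
    , ( 1ℝ + - α
      , Membership.S₋₃ {n} {d} -n≤d d≤-1 {1ℝ + - α} 1-α>0 (0<1-x⇒x<1 (1ℝ + - α) (reflected-positive {α} α>0))
          (reflected-cubic {α} {n} {d} root)
      , irrational⇒primitive {1ℝ + - α} (+-closed {1ℝ} { - α} 1-closed (neg-closed {α} α∈K)) (reflected-irrational {α} α∉ℚ) )

theorem12 : {ℓ : Level} (K : RealCubicField ℓ) → ¬ TotallyReal K →
    (Σ[ α ∈ ℝ ] α ∈ S (+ 0) × α ∈ IsPrimitiveElement K) ×
    (Σ[ α ∈ ℝ ] α ∈ S (ℤ.- (+ 3)) × α ∈ IsPrimitiveElement K)
theorem12 K ¬totally-real = small-root⇒primitive-elements K (small-root K ¬totally-real)
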